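{- Let $k \ge 3$, let $G$ be a $k$-dicritical digraph, and let $S = \{x \in V(G) : d(x) \le 2(k-1)\}$. Then the number of connected components of $G-S$ is at most the number of connected components of $G[S]$.
   Context: Digraphs are finite, without loops and parallel arcs (digons allowed). $d(x)=d^+(x)+d^-(x)$ where $d^+(x)$, $d^-(x)$ are the numbers of out- and in-neighbours. A dicolouring colours vertices so that each colour class induces an acyclic subdigraph; $\vec{\chi}$ is the minimum number of colours; $G$ is $k$-dicritical if $\vec{\chi}(G)=k$ and every proper subdigraph has smaller dichromatic number. Connectivity is weak connectivity (of the underlying undirected graph); a connected component is a maximal vertex set inducing a connected subdigraph. Convention: the empty set is considered connected, so the empty digraph has exactly one connected component (the empty set). -}

module Defs where

open import Data.Nat using (ℕ; zero; suc; _+_; _*_; _∸_; _≤_)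
open import Data.Fin using (Fin)
open import Data.Fin.Subset using (Subset; _∈_; _∉_; ∣_∣; ⊤; ∁)
open import Data.Bool using (Bool; true; false)
open import Data.Vec using (tabulate)
open import Data.Product using (Σ; _×_; ∃; _,_)
open import Data.Sum using (_⊎_)
open import Data.Empty using (⊥)
open import Relation.Nullary using (¬_)
open import Relation.Binary.PropositionalEquality using (_≡_)
open import Relation.Binary.Construct.Closure.Transitive using (TransClosure)
open import Relation.Binary.Construct.Closure.ReflexiveTransitive using (Star)

-- A finite digraph on vertex set Fin n: arc x y = true iff there is an arc x → y.
-- No loops; digons allowed (arc x y and arc y x may both hold); no parallel arcs
-- (arc relation is Boolean).
record Digraph : Set where
  field
    n        : ℕ
    arc      : Fin n → Fin n → Bool
    loopless : ∀ x → arc x x ≡ false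
open Digraph public

record Subdigraph (G : Digraph) : Set where
  field
    verts  : Subset (n G)
    arcs   : Fin (n G) → Fin (n G) → Bool
    arcs⊆  : ∀ x y → arcs x y ≡ true → (x ∈ verts) × (y ∈ verts) × (arc G x y ≡ true)
open Subdigraph public

whole : (G : Digraph) → Subdigraph G
whole G = record { verts = ⊤ ; arcs = arc G ; arcs⊆ = λ x y e → inside-⊤ x , inside-⊤ y , e }
  where
  open import Data.Fin.Subset.Properties using (∈⊤)
  inside-⊤ : ∀ (v : Fin (n G)) → v ∈ ⊤
  inside-⊤ v = ∈⊤

Proper : {G : Digraph} → Subdigraph G → Set
Proper {G} H = ¬ ((verts H ≡ ⊤) × (∀ x y → arcs H x y ≡ arc G x y))

-- a dicolouring of H with c colours: every colour class induces an acyclic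
-- subdigraph of H, i.e. there is no directed closed walk (of length ≥ 1, using
-- arcs of H) all of whose vertices have the same colour (equivalently, no
-- monochromatic directed cycle).
IsDicolouring : {G : Digraph} (H : Subdigraph G) (c : ℕ) → (Fin (n G) → Fin c) → Set
IsDicolouring {G} H c col =
  ∀ (i : Fin c) (x : Fin (n G)) →
    ¬ TransClosure (λ u v → (arcs H u v ≡ true) × (col u ≡ i) × (col v ≡ i)) x x

Dicolourable : {G : Digraph} → Subdigraph G → ℕ → Set
Dicolourable {G} H c = Σ (Fin (n G) → Fin c) (IsDicolouring H c)

DichromaticNumberIs : {G : Digraph} → Subdigraph G → ℕ → Set
DichromaticNumberIs H k = Dicolourable H k × (∀ c → Dicolourable H c → k ≤ c)

Dicritical : ℕ → Digraph → Set
Dicritical k G =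
  DichromaticNumberIs (whole G) k ×
  (∀ (H : Subdigraph G) → Proper H → Σ ℕ λ c → (suc c ≤ k) × Dicolourable H c)

outdeg indeg deg : (G : Digraph) → Fin (n G) → ℕ
outdeg G x = ∣ tabulate (λ y → arc G x y) ∣
indeg  G x = ∣ tabulate (λ y → arc G y x) ∣
deg G x = outdeg G x + indeg G x

LowSet : (k : ℕ) (G : Digraph) → Subset (n G)
LowSet k G = tabulate (λ x → isLow x)
  where
  open import Data.Nat using (_≤ᵇ_)
  isLow : Fin (n G) → Bool
  isLow x = deg G x ≤ᵇ (2 * (k ∸ 1))

Adj : (G : Digraph) → Subset (n G) → Fin (n G) → Fin (n G) → Set
Adj G X u v = (u ∈ X) × (v ∈ X) × ((arc G u v ≡ true) ⊎ (arc G v u ≡ true))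

ConnectedIn : (G : Digraph) → Subset (n G) → Fin (n G) → Fin (n G) → Set
ConnectedIn G X = Star (Adj G X)

-- G[X] has exactly m connected components.  For nonempty X: there is a labelling
-- of the vertices of X by Fin m, every label used, with two vertices of X getting the
-- same label iff they are connected in G[X].  By convention, the empty set is
-- connected, so G[∅] has exactly one component.
NumComponents : (G : Digraph) → Subset (n G) → ℕ → Set
NumComponents G X m =
  ((∀ x → x ∉ X) × (m ≡ 1)) ⊎
  ((∃ λ x → x ∈ X) ×
   Σ (Fin (n G) → Fin m) λ f →
     (∀ x y → x ∈ X → y ∈ X → (ConnectedIn G X x y → f x ≡ f y) × (f x ≡ f y → ConnectedIn G X x y)) ×
     (∀ (i : Fin m) → ∃ λ x → (x ∈ X) × (f x ≡ i)))

{-# OPTIONS --safe #-}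
module Submission where

-- Let c = k − 1, call the components of G − S parts and those of G[S] T_1, …, T_p, and let N(j)
-- be the set of parts adjacent to T_j.  Suppose there are more parts than T_j's.  Contracting a
-- largest set I of parts that contains at least |I| of the N(j), together with the
-- corresponding T_j's, yields a system in which every nonempty set I of parts contains fewer
-- than |I| of the remaining N(j).  Each part omits a vertex, so it is c-dicolourable by
-- criticality.
--
-- In such a system some j can be removed and any two parts a, b of N(j) merged without losing
-- the counting condition (submodularity).  Colour and absorb into a part the leaves of T_j that
-- see only that part, until some vertex v of T_j sees x and y in different parts; these take the
-- roles of a and b.  Permute the colours of one of them so that x and y agree, merge, solve the
-- smaller system, and then colour T_j greedily towards v.  Low vertices with an uncoloured
-- neighbour miss a colour among their in- or their out-neighbours; so does v, unless x and y are
-- the only in- and the only out-neighbour of their colour, in which case v takes that colour.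
-- Monochromatic cycles are excluded by a level function along which every monochromatic arc
-- ascends, except for arcs inside one part.

open import Defs
open import Data.Nat using (ℕ; _≤_)
open import Data.Fin.Subset using (∁)
open import Data.Bool using (Bool; true; false; T)
open import Data.Bool.Properties using () renaming (_≟_ to _≟ᵇ_)
open import Data.Empty using (⊥-elim)
open import Data.Fin using (Fin; zero; suc; _≟_; inject≤)
open import Data.Fin.Permutation.Components using (transpose; transpose-inverse)
open import Data.Fin.Properties using (any?; all?; ¬∀⟶∃¬; suc-injective; inject≤-injective)
open import Data.Fin.Subset using (Subset; _∈_; _∉_; _⊆_; ∣_∣; _-_; ⁅_⁆; Nonempty; Empty; _∩_; _∪_; ⊤)
  renaming (⊥ to ∅)
open import Data.Fin.Subset.Properties
open import Data.List using (List; []; _∷_; _++_)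
open import Data.List.Membership.DecPropositional using () renaming (_∈?_ to ∈ₗ?)
open import Data.List.Membership.Propositional using () renaming (_∈_ to _∈ₗ_; _∉_ to _∉ₗ_)
open import Data.List.Membership.Propositional.Properties using (∈-++⁺ˡ; ∈-++⁺ʳ; ∈-++⁻)
open import Data.List.Relation.Unary.Any using (here; there)
open import Data.Maybe as Maybe using (Maybe; just; nothing)
open import Data.Maybe.Properties using (just-injective; ≡-dec)
open import Data.Nat using (zero; suc; _+_; _*_; _∸_; _<_; z≤n; s≤s; s≤s⁻¹; _≤?_; _<?_; _≤ᵇ_)
open import Data.Nat.Properties hiding (_≟_; suc-injective; _≤?_; _<?_)
open import Data.Product using (∃; ∃₂; _×_; _,_; proj₁; proj₂)
open import Data.Sum using (_⊎_; inj₁; inj₂)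
open import Data.Vec using (tabulate; []; _∷_)
open import Data.Vec.Properties using (lookup∘tabulate; lookup⇒[]=; []=⇒lookup)
open import Function using (_∘_; case_of_)
open import Relation.Binary.Construct.Closure.ReflexiveTransitive using (ε; _◅_)
open import Relation.Binary.Construct.Closure.Transitive using (TransClosure; [_]; _∷_)
  renaming (_++_ to _++⁺_)
open import Relation.Binary.PropositionalEquality hiding ([_]; J)
open import Relation.Nullary using (¬_; Dec; yes; no; does; contradiction)
open import Relation.Nullary.Decidable using (_×-dec_; _⊎-dec_; ¬?; dec-true; decidable-stable; toSum)
open import Relation.Unary using (Decidable)

-- Merging in sparse set systems

∈-tabulate⁺ : ∀ {n} (f : Fin n → Bool) {x} → f x ≡ true → x ∈ tabulate f
∈-tabulate⁺ f {x} e = lookup⇒[]= x (tabulate f) (trans (lookup∘tabulate f x) e)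

∈-tabulate⁻ : ∀ {n} (f : Fin n → Bool) {x} → x ∈ tabulate f → f x ≡ true
∈-tabulate⁻ f {x} m = trans (sym (lookup∘tabulate f x)) ([]=⇒lookup m)

comprehension : ∀ {n} {P : Fin n → Set} → Decidable P → Subset n
comprehension P? = tabulate (does ∘ P?)

∈-comprehension⁺ : ∀ {n} {P : Fin n → Set} (P? : Decidable P) {x} → P x → x ∈ comprehension P?
∈-comprehension⁺ P? {x} p = ∈-tabulate⁺ (does ∘ P?) (dec-true (P? x) p)

∈-comprehension⁻ : ∀ {n} {P : Fin n → Set} (P? : Decidable P) {x} → x ∈ comprehension P? → P x
∈-comprehension⁻ P? {x} m with P? x | ∈-tabulate⁻ (does ∘ P?) m
... | yes p | _ = p
... | no _ | ()

∣∪∣+∣∩∣ : ∀ {n} (p q : Subset n) → ∣ p ∪ q ∣ + ∣ p ∩ q ∣ ≡ ∣ p ∣ + ∣ q ∣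
∣∪∣+∣∩∣ [] [] = refl
∣∪∣+∣∩∣ (true ∷ p) (true ∷ q) =
  cong suc (trans (+-suc _ _) (trans (cong suc (∣∪∣+∣∩∣ p q)) (sym (+-suc _ _))))
∣∪∣+∣∩∣ (true ∷ p) (false ∷ q) = cong suc (∣∪∣+∣∩∣ p q)
∣∪∣+∣∩∣ (false ∷ p) (true ∷ q) = trans (cong suc (∣∪∣+∣∩∣ p q)) (sym (+-suc _ _))
∣∪∣+∣∩∣ (false ∷ p) (false ∷ q) = ∣∪∣+∣∩∣ p q

∣p∪q∣≤∣p∣+∣q∣ : ∀ {n} (p q : Subset n) → ∣ p ∪ q ∣ ≤ ∣ p ∣ + ∣ q ∣
∣p∪q∣≤∣p∣+∣q∣ p q = ≤-trans (m≤m+n _ _) (≤-reflexive (∣∪∣+∣∩∣ p q))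

disjoint-∣∣ : ∀ {n} (p q r : Subset n) → p ⊆ r → q ⊆ r → (∀ {x} → x ∈ p → x ∉ q) →
              ∣ p ∣ + ∣ q ∣ ≤ ∣ r ∣
disjoint-∣∣ {n} p q r p⊆r q⊆r disj = begin
  ∣ p ∣ + ∣ q ∣          ≡⟨ sym (∣∪∣+∣∩∣ p q) ⟩
  ∣ p ∪ q ∣ + ∣ p ∩ q ∣  ≡⟨ cong (λ s → ∣ p ∪ q ∣ + ∣ s ∣) (Empty-unique {p = p ∩ q} empty) ⟩
  ∣ p ∪ q ∣ + ∣ ∅ {n} ∣    ≡⟨ cong (∣ p ∪ q ∣ +_) (∣⊥∣≡0 n) ⟩
  ∣ p ∪ q ∣ + 0          ≡⟨ +-identityʳ _ ⟩
  ∣ p ∪ q ∣              ≤⟨ p⊆q⇒∣p∣≤∣q∣ union⊆ ⟩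
  ∣ r ∣ ∎
  where
  open ≤-Reasoning
  empty : Empty (p ∩ q)
  empty (x , x∈) with x∈p∩q⁻ p q x∈
  ... | x∈p , x∈q = disj x∈p x∈q
  union⊆ : p ∪ q ⊆ r
  union⊆ x∈ with x∈p∪q⁻ p q x∈
  ... | inj₁ x∈p = p⊆r x∈p
  ... | inj₂ x∈q = q⊆r x∈q

x∉p-x : ∀ {n} (p : Subset n) (x : Fin n) → x ∉ p - x
x∉p-x (s ∷ p) zero ()
x∉p-x (s ∷ p) (suc x) m = x∉p-x p x (drop-there m)

x∈p⇒0<∣p∣ : ∀ {n} {p : Subset n} {x} → x ∈ p → 0 < ∣ p ∣
x∈p⇒0<∣p∣ x∈p = ≤-trans (s≤s z≤n) (x∈p⇒∣p-x∣<∣p∣ x∈p)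

two-elements : ∀ {n} {p : Subset n} {x y} → x ∈ p → y ∈ p → x ≢ y → 2 ≤ ∣ p ∣
two-elements x∈p y∈p x≢y =
  ≤-trans (s≤s (x∈p⇒0<∣p∣ (x∈p∧x≢y⇒x∈p-y x∈p x≢y))) (x∈p⇒∣p-x∣<∣p∣ y∈p)

least : ∀ {n} {P : Subset n → Set} → Decidable P → (μ : Subset n → ℕ) → ∃ P →
        ∃ λ K → P K × (∀ K′ → P K′ → μ K ≤ μ K′)
least {P = P} P? μ (K , pK) = search (μ K) K pK ≤-refl
  where
  search : ∀ m K → P K → μ K ≤ m → ∃ λ K → P K × (∀ K′ → P K′ → μ K ≤ μ K′)
  search m K pK K≤m with anySubset? (λ K′ → P? K′ ×-dec (μ K′ <? μ K))
  search m K pK K≤m | no none = K , pK , λ K′ pK′ → ≮⇒≥ (λ lt → none (K′ , pK′ , lt))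
  search zero K pK K≤m | yes (K′ , pK′ , lt) = contradiction (≤-trans lt K≤m) λ ()
  search (suc m) K pK K≤m | yes (K′ , pK′ , lt) = search m K′ pK′ (s≤s⁻¹ (≤-trans lt K≤m))

abstract
  enclosed : ∀ {p m} → Subset p → (Fin p → Subset m) → Subset m → Subset p
  enclosed J N I = comprehension (λ j → (j ∈? J) ×-dec (N j ⊆? I))

  ∈-enclosed⁺ : ∀ {p m} {J : Subset p} {N : Fin p → Subset m} {I j} →
                j ∈ J → N j ⊆ I → j ∈ enclosed J N I
  ∈-enclosed⁺ {J = J} {N} {I} j∈J N⊆I = ∈-comprehension⁺ (λ j → (j ∈? J) ×-dec (N j ⊆? I)) (j∈J , N⊆I)

  ∈-enclosed⁻ : ∀ {p m} {J : Subset p} {N : Fin p → Subset m} {I j} →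
                j ∈ enclosed J N I → j ∈ J × N j ⊆ I
  ∈-enclosed⁻ {J = J} {N} {I} = ∈-comprehension⁻ (λ j → (j ∈? J) ×-dec (N j ⊆? I))

-- Independence of the family `N j`, `j ∈ J`, in the hypergraphic matroid on `Fin m`. If every `N j`
-- has two elements, this says that these edges form a forest.
Sparse : ∀ {p m} → Subset p → (Fin p → Subset m) → Set
Sparse J N = ∀ I → Nonempty I → ∣ enclosed J N I ∣ < ∣ I ∣

sparse⇒⊈singleton : ∀ {p m} {J : Subset p} {N : Fin p → Subset m} → Sparse J N →
                    ∀ {j} → j ∈ J → ∀ a → ¬ (N j ⊆ ⁅ a ⁆)
sparse⇒⊈singleton {J = J} {N} sparse {j} j∈J a N⊆ = n≮n 1 (begin-strict
  1                         ≤⟨ x∈p⇒0<∣p∣ (∈-enclosed⁺ j∈J N⊆) ⟩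
  ∣ enclosed J N ⁅ a ⁆ ∣    <⟨ sparse ⁅ a ⁆ (a , x∈⁅x⁆ a) ⟩
  ∣ ⁅ a ⁆ ∣                 ≡⟨ ∣⁅x⁆∣≡1 a ⟩
  1                         ∎)
  where open ≤-Reasoning

-- Sparsity is vacuous for `m = 0`. The given element of `Fin m` yields a singleton, which would
-- enclose an empty `N j`.
sparse⇒two : ∀ {p m} {J : Subset p} {N : Fin p → Subset m} → Sparse J N → Fin m → ∀ {j} → j ∈ J →
             ∃₂ λ a b → a ≢ b × a ∈ N j × b ∈ N j
sparse⇒two {N = N} sparse i₀ {j} j∈J
  with any? (λ a → any? (λ b → ¬? (a ≟ b) ×-dec ((a ∈? N j) ×-dec (b ∈? N j))))
... | yes two = two
... | no none with nonempty? (N j)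
...   | no empty = ⊥-elim (sparse⇒⊈singleton sparse j∈J i₀ λ x∈ → contradiction (_ , x∈) empty)
...   | yes (a , a∈) = ⊥-elim (sparse⇒⊈singleton sparse j∈J a only-a)
  where
  only-a : N j ⊆ ⁅ a ⁆
  only-a {b} b∈ with a ≟ b
  ... | yes refl = x∈⁅x⁆ a
  ... | no a≢b = contradiction (a , b , a≢b , a∈ , b∈) none

-- The index set stays `Fin m` after a merge: for `a ≢ b`, the index `b` merely lies in no
-- redirected set. Hence the number of labels is constant along the recursion.
redirect : ∀ {m} → Fin m → Fin m → Fin m → Fin m
redirect a b i with i ≟ b
... | yes _ = a
... | no _ = i

abstract
  image : ∀ {m k} → (Fin m → Fin k) → Subset m → Subset k
  image f P = comprehension (λ y → any? (λ x → (x ∈? P) ×-dec (f x ≟ y)))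

  ∈-image⁺ : ∀ {m k} (f : Fin m → Fin k) {P x} → x ∈ P → f x ∈ image f P
  ∈-image⁺ f {P} {x} x∈P = ∈-comprehension⁺ (λ y → any? (λ x → (x ∈? P) ×-dec (f x ≟ y))) (x , x∈P , refl)

  ∈-image⁻ : ∀ {m k} (f : Fin m → Fin k) {P y} → y ∈ image f P → ∃ λ x → x ∈ P × f x ≡ y
  ∈-image⁻ f {P} = ∈-comprehension⁻ (λ y → any? (λ x → (x ∈? P) ×-dec (f x ≟ y)))

-- A redirected set inside `I` comes from a set inside `I` if `a ∉ I`, and from one inside
-- `K = I ∪ ⁅ b ⁆` otherwise. The second case costs one element. It is repaid by the removal of `j`
-- if `K` encloses `N j`, and by the assumed slack at `K` if not.
merge-sparse : ∀ {p m} {J : Subset p} {N : Fin p → Subset m} → Sparse J N → ∀ {j a b} →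
  (∀ K → a ∈ K → b ∈ K → j ∉ enclosed J N K → suc ∣ enclosed J N K ∣ < ∣ K ∣) →
  Sparse (J - j) (image (redirect a b) ∘ N)
merge-sparse {J = J} {N} sparse {j} {a} {b} slack I (i₀ , i₀∈I) with a ∈? I
... | no a∉I = ≤-trans (s≤s (p⊆q⇒∣p∣≤∣q∣ sub)) (sparse I (i₀ , i₀∈I))
  where
  sub : enclosed (J - j) (image (redirect a b) ∘ N) I ⊆ enclosed J N I
  sub {j′} m with ∈-enclosed⁻ m
  ... | j′∈ , N⊆ = ∈-enclosed⁺ (p─q⊆p J ⁅ j ⁆ j′∈) back
    where
    back : N j′ ⊆ I
    back {i} i∈ with i ≟ b | N⊆ (∈-image⁺ (redirect a b) i∈)
    ... | yes _ | a∈I = contradiction a∈I a∉I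
    ... | no _ | i∈I = i∈I
... | yes a∈I = bound (j ∈? enclosed J N K)
  where
  K = I ∪ ⁅ b ⁆
  a∈K : a ∈ K
  a∈K = x∈p∪q⁺ (inj₁ a∈I)
  b∈K : b ∈ K
  b∈K = x∈p∪q⁺ (inj₂ (x∈⁅x⁆ b))
  ∣K∣≤ : ∣ K ∣ ≤ suc ∣ I ∣
  ∣K∣≤ = ≤-trans (∣p∪q∣≤∣p∣+∣q∣ I ⁅ b ⁆)
    (≤-reflexive (trans (cong (∣ I ∣ +_) (∣⁅x⁆∣≡1 b)) (+-comm _ 1)))
  J′ = enclosed (J - j) (image (redirect a b) ∘ N) I
  sub : J′ ⊆ enclosed J N K - j
  sub {j′} m with ∈-enclosed⁻ m
  ... | j′∈ , N⊆ = x∈p∧x≢y⇒x∈p-y (∈-enclosed⁺ (p─q⊆p J ⁅ j ⁆ j′∈) back) λ { refl → x∉p-x J j j′∈ }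
    where
    back : N j′ ⊆ K
    back {i} i∈ with i ≟ b | N⊆ (∈-image⁺ (redirect a b) i∈)
    ... | yes refl | _ = b∈K
    ... | no _ | i∈I = x∈p∪q⁺ (inj₁ i∈I)
  open ≤-Reasoning
  bound : Dec (j ∈ enclosed J N K) → ∣ J′ ∣ < ∣ I ∣
  bound (yes j∈) = s≤s⁻¹ (begin-strict
    suc ∣ J′ ∣                    ≤⟨ s≤s (p⊆q⇒∣p∣≤∣q∣ sub) ⟩
    suc ∣ enclosed J N K - j ∣    ≤⟨ x∈p⇒∣p-x∣<∣p∣ j∈ ⟩
    ∣ enclosed J N K ∣            <⟨ sparse K (a , a∈K) ⟩
    ∣ K ∣                         ≤⟨ ∣K∣≤ ⟩
    suc ∣ I ∣                     ∎)
  bound (no j∉) = s≤s⁻¹ (begin-strict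
    suc ∣ J′ ∣                    ≤⟨ s≤s (p⊆q⇒∣p∣≤∣q∣ sub) ⟩
    suc ∣ enclosed J N K - j ∣    ≤⟨ s≤s (∣p─q∣≤∣p∣ (enclosed J N K) ⁅ j ⁆) ⟩
    suc ∣ enclosed J N K ∣        <⟨ slack K a∈K b∈K j∉ ⟩
    ∣ K ∣                         ≤⟨ ∣K∣≤ ⟩
    suc ∣ I ∣                     ∎)

-- Only tight sets, those with `∣ enclosed J N K ∣ = ∣ K ∣ - 1`, can obstruct a merge. If there are
-- none, any `j` will do; otherwise `j` is taken inside a smallest tight set `K₀`.
mergeable : ∀ {p m} {J : Subset p} {N : Fin p → Subset m} → Sparse J N → Nonempty J →
  ∃ λ j → j ∈ J × (∀ {a b} → a ≢ b → a ∈ N j → b ∈ N j → Sparse (J - j) (image (redirect a b) ∘ N))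
mergeable {p} {J = J} {N} sparse (j₁ , j₁∈J) with anySubset? tight?
  where
  -- The bound `2 ≤ ∣ K ∣` discards singletons, which would all be tight, and forces a tight set to
  -- enclose some `N j`.
  tight? : Decidable (λ K → 2 ≤ ∣ K ∣ × ∣ K ∣ ≤ suc ∣ enclosed J N K ∣)
  tight? K = (2 ≤? ∣ K ∣) ×-dec (∣ K ∣ ≤? suc ∣ enclosed J N K ∣)
... | no none = j₁ , j₁∈J , λ a≢b _ _ → merge-sparse sparse
        λ K a∈K b∈K _ → ≰⇒> λ le → none (K , two-elements a∈K b∈K a≢b , le)
... | yes some with least (λ K → (2 ≤? ∣ K ∣) ×-dec (∣ K ∣ ≤? suc ∣ enclosed J N K ∣)) ∣_∣ some
...   | K₀ , (2≤K₀ , K₀≤) , minimal with nonempty? (enclosed J N K₀)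
...     | no empty = contradiction
            (≤-trans 2≤K₀ (≤-trans K₀≤
              (s≤s (≤-reflexive (trans (cong ∣_∣ (Empty-unique empty)) (∣⊥∣≡0 p))))))
            λ { (s≤s ()) }
...     | yes (j , j∈K₀) = j , proj₁ (∈-enclosed⁻ j∈K₀) , λ a≢b a∈ b∈ →
            merge-sparse sparse (slack a≢b a∈ b∈)
  where
  -- If K were tight, so would be K ∩ K₀ by submodularity; it is smaller than K₀ as it misses
  -- an element of N j.
  slack : ∀ {a b} → a ≢ b → a ∈ N j → b ∈ N j →
          ∀ K → a ∈ K → b ∈ K → j ∉ enclosed J N K → suc ∣ enclosed J N K ∣ < ∣ K ∣
  slack {a} {b} a≢b a∈ b∈ K a∈K b∈K j∉K = ≰⇒> λ K≤ → j∉K (smaller (meet-tight K≤))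
    where
    N⊆K₀ = proj₂ (∈-enclosed⁻ {J = J} {N} j∈K₀)
    a∈∩ : a ∈ K ∩ K₀
    a∈∩ = x∈p∩q⁺ (a∈K , N⊆K₀ a∈)
    b∈∩ : b ∈ K ∩ K₀
    b∈∩ = x∈p∩q⁺ (b∈K , N⊆K₀ b∈)
    s∪ : enclosed J N K ∪ enclosed J N K₀ ⊆ enclosed J N (K ∪ K₀)
    s∪ m with x∈p∪q⁻ (enclosed J N K) _ m
    ... | inj₁ x = let (y , z) = ∈-enclosed⁻ x in ∈-enclosed⁺ y (λ i → x∈p∪q⁺ (inj₁ (z i)))
    ... | inj₂ x = let (y , z) = ∈-enclosed⁻ x in ∈-enclosed⁺ y (λ i → x∈p∪q⁺ (inj₂ (z i)))
    s∩ : enclosed J N K ∩ enclosed J N K₀ ⊆ enclosed J N (K ∩ K₀)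
    s∩ m with x∈p∩q⁻ (enclosed J N K) _ m
    ... | x , x′ = let (y , z) = ∈-enclosed⁻ x ; (_ , z′) = ∈-enclosed⁻ x′ in
      ∈-enclosed⁺ y (λ i → x∈p∩q⁺ (z i , z′ i))
    open ≤-Reasoning
    meet-tight : ∣ K ∣ ≤ suc ∣ enclosed J N K ∣ → ∣ K ∩ K₀ ∣ ≤ suc ∣ enclosed J N (K ∩ K₀) ∣
    meet-tight K≤ = +-cancelˡ-≤ ∣ K ∪ K₀ ∣ _ _ (begin
      ∣ K ∪ K₀ ∣ + ∣ K ∩ K₀ ∣ ≡⟨ ∣∪∣+∣∩∣ K K₀ ⟩
      ∣ K ∣ + ∣ K₀ ∣ ≤⟨ +-mono-≤ K≤ K₀≤ ⟩
      suc ∣ enclosed J N K ∣ + suc ∣ enclosed J N K₀ ∣ ≡⟨ +-suc (suc ∣ enclosed J N K ∣) _ ⟩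
      suc (suc (∣ enclosed J N K ∣ + ∣ enclosed J N K₀ ∣))
        ≡⟨ cong (2 +_) (sym (∣∪∣+∣∩∣ (enclosed J N K) (enclosed J N K₀))) ⟩
      suc (suc (∣ enclosed J N K ∪ enclosed J N K₀ ∣ + ∣ enclosed J N K ∩ enclosed J N K₀ ∣))
        ≤⟨ s≤s (s≤s (+-mono-≤ (p⊆q⇒∣p∣≤∣q∣ s∪) (p⊆q⇒∣p∣≤∣q∣ s∩))) ⟩
      suc (suc (∣ enclosed J N (K ∪ K₀) ∣ + ∣ enclosed J N (K ∩ K₀) ∣))
        ≤⟨ s≤s (+-monoˡ-≤ _ (sparse (K ∪ K₀) (a , x∈p∪q⁺ (inj₁ a∈K)))) ⟩
      suc (∣ K ∪ K₀ ∣ + ∣ enclosed J N (K ∩ K₀) ∣) ≡⟨ sym (+-suc _ _) ⟩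
      ∣ K ∪ K₀ ∣ + suc ∣ enclosed J N (K ∩ K₀) ∣ ∎)
    smaller : ∣ K ∩ K₀ ∣ ≤ suc ∣ enclosed J N (K ∩ K₀) ∣ → j ∈ enclosed J N K
    smaller tight = ∈-enclosed⁺ (proj₁ (∈-enclosed⁻ j∈K₀)) λ {i} i∈ → decidable-stable (i ∈? K) λ i∉K →
      <⇒≱ (p⊂q⇒∣p∣<∣q∣ ((p∩q⊆q K K₀) , i , N⊆K₀ i∈ , λ i∈∩ → i∉K (proj₁ (x∈p∩q⁻ K K₀ i∈∩))))
          (minimal (K ∩ K₀) (two-elements a∈∩ b∈∩ a≢b , tight))

does⁻ : ∀ {P : Set} (P? : Dec P) → does P? ≡ true → P
does⁻ (yes p) _ = p

-- Extending colourings

Misses : ∀ {n c} → Subset n → (Fin n → Fin c) → Fin c → Set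
Misses A ψ γ = ∀ {u} → u ∈ A → ψ u ≢ γ

injection⇒≤ : ∀ {n} c (A : Subset n) (g : Fin c → Fin n) →
              (∀ {i j} → g i ≡ g j → i ≡ j) → (∀ i → g i ∈ A) → c ≤ ∣ A ∣
injection⇒≤ zero A g inj g∈ = z≤n
injection⇒≤ (suc c) A g inj g∈ =
  ≤-trans (s≤s (injection⇒≤ c (A - g zero) (g ∘ suc) (suc-injective ∘ inj)
                 (λ i → x∈p∧x≢y⇒x∈p-y (g∈ (suc i)) λ e → case inj e of λ ())))
          (x∈p⇒∣p-x∣<∣p∣ (g∈ zero))

missed-colour : ∀ {n c} (A : Subset n) (ψ : Fin n → Fin c) → ∃ (Misses A ψ) ⊎ c ≤ ∣ A ∣
missed-colour {n} {c} A ψ with all? (λ γ → any? (λ u → (u ∈? A) ×-dec (ψ u ≟ γ)))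
... | yes hit = inj₂ (injection⇒≤ c A (proj₁ ∘ hit)
        (λ {i} {j} e → trans (sym (proj₂ (proj₂ (hit i)))) (trans (cong ψ e) (proj₂ (proj₂ (hit j)))))
        (proj₁ ∘ proj₂ ∘ hit))
... | no ¬hit with ¬∀⟶∃¬ c _ (λ γ → any? (λ u → (u ∈? A) ×-dec (ψ u ≟ γ))) ¬hit
...   | γ , none = inj₁ (γ , λ u∈ e → none (_ , u∈ , e))

free-colour : ∀ {n c} (A B : Subset n) (ψ : Fin n → Fin c) → ∣ A ∣ + ∣ B ∣ < c + c →
              ∃ λ γ → Misses A ψ γ ⊎ Misses B ψ γ
free-colour A B ψ few with missed-colour A ψ | missed-colour B ψ
... | inj₁ (γ , m) | _ = γ , inj₁ m
... | inj₂ _ | inj₁ (γ , m) = γ , inj₂ m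
... | inj₂ a | inj₂ b = contradiction (+-mono-≤ a b) (<⇒≱ few)

update : ∀ {m} {A : Set} → Fin m → A → (Fin m → A) → Fin m → A
update z a f u with u ≟ z
... | yes _ = a
... | no _ = f u

update-same : ∀ {m} {A : Set} (z : Fin m) (a : A) f → update z a f z ≡ a
update-same z a f with z ≟ z
... | yes _ = refl
... | no z≢z = contradiction refl z≢z

update-other : ∀ {m} {A : Set} (z : Fin m) (a : A) f {u} → u ≢ z → update z a f u ≡ f u
update-other z a f {u} u≢z with u ≟ z
... | yes e = contradiction e u≢z
... | no _ = refl

transpose-left : ∀ {c} (i j : Fin c) → transpose i j i ≡ j
transpose-left i j with i ≟ i
... | yes _ = refl
... | no i≢i = contradiction refl i≢i

transpose-injective : ∀ {c} (i j : Fin c) {k l} → transpose i j k ≡ transpose i j l → k ≡ l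
transpose-injective i j e =
  trans (sym (transpose-inverse j i)) (trans (cong (transpose j i) e) (transpose-inverse j i))

module _ (G : Digraph) where

  private
    V = Fin (n G)

  Out In : V → Subset (n G)
  Out x = tabulate (λ y → arc G x y)
  In x = tabulate (λ y → arc G y x)

  _∼_ : V → V → Set
  x ∼ y = arc G x y ≡ true ⊎ arc G y x ≡ true

  ∼-sym : ∀ {x y} → x ∼ y → y ∼ x
  ∼-sym (inj₁ e) = inj₂ e
  ∼-sym (inj₂ e) = inj₁ e

  _∼?_ : ∀ x y → Dec (x ∼ y)
  x ∼? y = (arc G x y ≟ᵇ true) ⊎-dec (arc G y x ≟ᵇ true)

  no-loop : ∀ {x} {A : Set} → arc G x x ≡ true → A
  no-loop {x} e with trans (sym (loopless G x)) e
  ... | ()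

  -- Lists z₁ ∷ … ∷ r ∷ [] in which every entry but r has a neighbour further right, so
  -- connected sets from which the head can be removed.
  data Tree (r : V) : List V → Set where
    root  : Tree r (r ∷ [])
    graft : ∀ {z y ys} → Tree r ys → z ∉ₗ ys → y ∈ₗ ys → z ∼ y → Tree r (z ∷ ys)

  replant : ∀ {r z ys} → Tree r ys → z ∉ₗ ys → r ∼ z → Tree z (ys ++ z ∷ [])
  replant {r} {z} root z∉ r∼z =
    graft root (λ { (here e) → z∉ (here (sym e)) }) (here refl) r∼z
  replant (graft t w∉ y∈ w∼y) z∉ r∼z =
    graft (replant t (z∉ ∘ there) r∼z)
          (λ m → case ∈-++⁻ _ m of λ { (inj₁ m′) → w∉ m′ ; (inj₂ (here e)) → z∉ (here (sym e)) })
          (∈-++⁺ˡ y∈) w∼y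

  root∈ : ∀ {r ys} → Tree r ys → r ∈ₗ ys
  root∈ root = here refl
  root∈ (graft t _ _ _) = there (root∈ t)

  record Rerooted (v : V) (ys : List V) : Set where
    constructor rerooted
    field
      {list} : List V
      tree   : Tree v list
      to     : ∀ {u} → u ∈ₗ ys → u ∈ₗ list
      from   : ∀ {u} → u ∈ₗ list → u ∈ₗ ys

  -- To make the head `z` the root, the rest is first rerooted at the neighbour `y` of `z`. Then `z`
  -- can be moved behind `y`, which is now last and has `z` as its neighbour further right.
  reroot : ∀ {r v ys} → Tree r ys → v ∈ₗ ys → Rerooted v ys
  reroot root (here refl) = rerooted root (λ m → m) (λ m → m)
  reroot (graft {z} {y} t z∉ y∈ z∼y) (here refl) with reroot t y∈
  ... | rerooted {ys′} t′ to from = rerooted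
    (replant t′ (z∉ ∘ from) (∼-sym z∼y))
    (λ { (here e) → ∈-++⁺ʳ ys′ (here e) ; (there m) → ∈-++⁺ˡ (to m) })
    (λ m → case ∈-++⁻ ys′ m of λ { (inj₁ m′) → there (from m′) ; (inj₂ (here e)) → here e })
  reroot (graft {z} {y} t z∉ y∈ z∼y) (there v∈) with reroot t v∈
  ... | rerooted t′ to from = rerooted (graft t′ (z∉ ∘ from) (to y∈) z∼y)
    (λ { (here e) → here e ; (there m) → there (to m) })
    (λ { (here e) → here e ; (there m) → there (from m) })

  module Colouring {c M : ℕ} where

    Labels = V → Maybe (Fin M)

    -- The vertices with a label are precoloured by φ, and labels are parts: ψ may permute the
    -- colours of each part separately.  A monochromatic cycle of ψ within X cannot ascend in ρ,
    -- so it lies in one part and is already monochromatic under φ.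
    record Extension (ℓ : Labels) (φ : V → Fin c) (X : V → Set) : Set where
      field
        ψ       : V → Fin c
        ρ       : V → ℕ
        keep    : ∀ {i u w} → ℓ u ≡ just i → ℓ w ≡ just i → φ u ≡ φ w → ψ u ≡ ψ w
        reflect : ∀ {i u w} → ℓ u ≡ just i → ℓ w ≡ just i → ψ u ≡ ψ w → φ u ≡ φ w
        level   : ∀ {i u w} → ℓ u ≡ just i → ℓ w ≡ just i → ρ u ≡ ρ w
        climb   : ∀ {u w} → X u → X w → arc G u w ≡ true → ψ u ≡ ψ w →
                  ρ u < ρ w ⊎ (∃ λ i → ℓ u ≡ just i × ℓ w ≡ just i)

    restrict : ∀ {ℓ φ} {X X′ : V → Set} → (∀ {u} → X′ u → X u) → Extension ℓ φ X → Extension ℓ φ X′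
    restrict sub e = record
      { ψ = ψ ; ρ = ρ ; keep = keep ; reflect = reflect ; level = level
      ; climb = λ xu xw → climb (sub xu) (sub xw) }
      where open Extension e

    labelled≢ : ∀ {ℓ : Labels} {z u i} → ℓ z ≡ nothing → ℓ u ≡ just i → u ≢ z
    labelled≢ z0 uj refl with trans (sym z0) uj
    ... | ()

    -- Only the arcs at `z` need checking: elsewhere `mono` transfers each ascent to the new levels,
    -- and ties inside a part depend only on labels.
    add : ∀ {ℓ φ X z} (e : Extension ℓ φ X) → let open Extension e in
          ℓ z ≡ nothing → (γ : Fin c) (ρ′ : V → ℕ) →
          (∀ {i u w} → ℓ u ≡ just i → ℓ w ≡ just i → ρ′ u ≡ ρ′ w) →
          (∀ {u w} → ρ u < ρ w → u ≢ z → w ≢ z → ρ′ u < ρ′ w) →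
          (∀ {u} → X u → u ≢ z → arc G u z ≡ true → ψ u ≡ γ → ρ′ u < ρ′ z) →
          (∀ {u} → X u → u ≢ z → arc G z u ≡ true → ψ u ≡ γ → ρ′ z < ρ′ u) →
          Extension ℓ φ (λ u → X u ⊎ u ≡ z)
    add {ℓ} {φ} {X} {z} e z0 γ ρ′ level′ mono below above = record
      { ψ = ψ′ ; ρ = ρ′
      ; keep = λ {_} {u} {w} lu lw q →
          trans (old (labelled≢ z0 lu)) (trans (keep lu lw q) (sym (old (labelled≢ z0 lw))))
      ; reflect = λ lu lw q →
          reflect lu lw (trans (sym (old (labelled≢ z0 lu))) (trans q (old (labelled≢ z0 lw))))
      ; level = level′
      ; climb = climb′ }
      where
      open Extension e
      ψ′ = update z γ ψ
      old : ∀ {u} → u ≢ z → ψ′ u ≡ ψ u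
      old = update-other z γ ψ
      new : ψ′ z ≡ γ
      new = update-same z γ ψ
      cases : ∀ {u} → X u ⊎ u ≡ z → u ≡ z ⊎ (u ≢ z × X u)
      cases (inj₂ e) = inj₁ e
      cases {u} (inj₁ x) with u ≟ z
      ... | yes e = inj₁ e
      ... | no ne = inj₂ (ne , x)
      climb′ : ∀ {u w} → X u ⊎ u ≡ z → X w ⊎ w ≡ z → arc G u w ≡ true → ψ′ u ≡ ψ′ w →
               ρ′ u < ρ′ w ⊎ (∃ λ i → ℓ u ≡ just i × ℓ w ≡ just i)
      climb′ xu xw a q with cases xu | cases xw
      ... | inj₁ refl | inj₁ refl = no-loop a
      ... | inj₁ refl | inj₂ (w≢z , x) = inj₁ (above x w≢z a (trans (sym (old w≢z)) (trans (sym q) new)))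
      ... | inj₂ (u≢z , x) | inj₁ refl = inj₁ (below x u≢z a (trans (sym (old u≢z)) (trans q new)))
      ... | inj₂ (u≢z , xu′) | inj₂ (w≢z , xw′)
        with climb xu′ xw′ a (trans (sym (old u≢z)) (trans q (old w≢z)))
      ...   | inj₁ lt = inj₁ (mono lt u≢z w≢z)
      ...   | inj₂ tie = inj₂ tie

    bound : ∀ {m} (ρ : Fin m → ℕ) → ∃ λ b → ∀ u → ρ u < b
    bound {zero} ρ = 0 , λ ()
    bound {suc m} ρ with bound (ρ ∘ suc)
    ... | b , lt = suc (ρ zero) + b , λ
      { zero → m≤m+n _ b ; (suc u) → ≤-trans (lt u) (m≤n+m b _) }

    -- If `γ` is missing among the in-neighbours, `z` is a source of its colour class and goes to
    -- level 0, below all others. If it is missing among the out-neighbours, `z` is a sink and goes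
    -- above all others.
    add-free : ∀ {ℓ φ X z γ} (e : Extension ℓ φ X) → let open Extension e in ℓ z ≡ nothing →
               (∀ {u} → X u → arc G u z ≡ true → ψ u ≢ γ) ⊎ (∀ {u} → X u → arc G z u ≡ true → ψ u ≢ γ) →
               Extension ℓ φ (λ u → X u ⊎ u ≡ z)
    add-free {ℓ} {φ} {X} {z} {γ} e z0 (inj₁ none) =
      add e z0 γ ρ′
        (λ lu lw → trans (old (labelled≢ z0 lu)) (trans (cong suc (level lu lw)) (sym (old (labelled≢ z0 lw)))))
        (λ lt u≢z w≢z → subst₂ _<_ (sym (old u≢z)) (sym (old w≢z)) (s≤s lt))
        (λ x _ a q → contradiction q (none x a))
        (λ x u≢z a q → subst₂ _<_ (sym new) (sym (old u≢z)) (s≤s z≤n))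
      where
      open Extension e
      ρ′ = update z 0 (suc ∘ ρ)
      old : ∀ {u} → u ≢ z → ρ′ u ≡ suc (ρ u)
      old = update-other z 0 (suc ∘ ρ)
      new : ρ′ z ≡ 0
      new = update-same z 0 (suc ∘ ρ)
    add-free {ℓ} {φ} {X} {z} {γ} e z0 (inj₂ none) =
      add e z0 γ ρ′
        (λ lu lw → trans (old (labelled≢ z0 lu)) (trans (level lu lw) (sym (old (labelled≢ z0 lw)))))
        (λ lt u≢z w≢z → subst₂ _<_ (sym (old u≢z)) (sym (old w≢z)) lt)
        (λ {u} x u≢z a q → subst₂ _<_ (sym (old u≢z)) (sym new) (proj₂ (bound ρ) u))
        (λ x _ a q → contradiction q (none x a))
      where
      open Extension e
      b = proj₁ (bound ρ)
      ρ′ = update z b ρ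
      old : ∀ {u} → u ≢ z → ρ′ u ≡ ρ u
      old = update-other z b ρ
      new : ρ′ z ≡ b
      new = update-same z b ρ

    Low : V → Set
    Low x = deg G x ≤ c + c

    -- The neighbour `y` accounts for at least one of the at most 2c arcs at `z`. Without it, fewer
    -- than c in-neighbours or fewer than c out-neighbours remain.
    free-colour-but-one : ∀ {z y} (ψ : V → Fin c) → Low z → z ∼ y →
      ∃ λ γ → (∀ {u} → u ≢ y → arc G u z ≡ true → ψ u ≢ γ) ⊎ (∀ {u} → u ≢ y → arc G z u ≡ true → ψ u ≢ γ)
    free-colour-but-one {z} {y} ψ low (inj₁ a)
      with free-colour (In z) (Out z - y) ψ (≤-trans (≤-reflexive (sym (+-suc _ _)))
             (≤-trans (+-monoʳ-≤ ∣ In z ∣ (x∈p⇒∣p-x∣<∣p∣ (∈-tabulate⁺ (λ y → arc G z y) a)))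
               (≤-trans (≤-reflexive (+-comm ∣ In z ∣ _)) low)))
    ... | γ , inj₁ m = γ , inj₁ λ _ b → m (∈-tabulate⁺ (λ y → arc G y z) b)
    ... | γ , inj₂ m = γ , inj₂ λ u≢y b → m (x∈p∧x≢y⇒x∈p-y (∈-tabulate⁺ (λ y → arc G z y) b) u≢y)
    free-colour-but-one {z} {y} ψ low (inj₂ a)
      with free-colour (In z - y) (Out z) ψ
             (≤-trans (+-monoˡ-≤ ∣ Out z ∣ (x∈p⇒∣p-x∣<∣p∣ (∈-tabulate⁺ (λ y → arc G y z) a)))
               (≤-trans (≤-reflexive (+-comm ∣ In z ∣ _)) low))
    ... | γ , inj₁ m = γ , inj₁ λ u≢y b → m (x∈p∧x≢y⇒x∈p-y (∈-tabulate⁺ (λ y → arc G y z) b) u≢y)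
    ... | γ , inj₂ m = γ , inj₂ λ _ b → m (∈-tabulate⁺ (λ y → arc G z y) b)

    FreeAt : (V → Fin c) → V → Set
    FreeAt ψ z = ∃ λ γ → (∀ {u} → arc G u z ≡ true → ψ u ≢ γ) ⊎ (∀ {u} → arc G z u ≡ true → ψ u ≢ γ)

    -- Since `y` repeats the colour of `x`, it can be left out of the count: a colour missed by the
    -- other in-neighbours is missed by `y` too.
    repeat-in : ∀ {z x y} (ψ : V → Fin c) → Low z → arc G x z ≡ true → arc G y z ≡ true →
                x ≢ y → ψ x ≡ ψ y → FreeAt ψ z
    repeat-in {z} {x} {y} ψ low ax ay x≢y q
      with free-colour (In z - y) (Out z) ψ
             (≤-trans (+-monoˡ-≤ ∣ Out z ∣ (x∈p⇒∣p-x∣<∣p∣ (∈-tabulate⁺ (λ y → arc G y z) ay)))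
               (≤-trans (≤-reflexive (+-comm ∣ In z ∣ _)) low))
    ... | γ , inj₂ m = γ , inj₂ λ b → m (∈-tabulate⁺ (λ y → arc G z y) b)
    ... | γ , inj₁ m = γ , inj₁ all
      where
      m′ : ∀ {u} → arc G u z ≡ true → u ≢ y → ψ u ≢ γ
      m′ b u≢y = m (x∈p∧x≢y⇒x∈p-y (∈-tabulate⁺ (λ y → arc G y z) b) u≢y)
      all : ∀ {u} → arc G u z ≡ true → ψ u ≢ γ
      all {u} b with u ≟ y
      ... | yes refl = λ e → m′ ax x≢y (trans q e)
      ... | no u≢y = m′ b u≢y

    repeat-out : ∀ {z x y} (ψ : V → Fin c) → Low z → arc G z x ≡ true → arc G z y ≡ true →
                 x ≢ y → ψ x ≡ ψ y → FreeAt ψ z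
    repeat-out {z} {x} {y} ψ low ax ay x≢y q
      with free-colour (In z) (Out z - y) ψ (≤-trans (≤-reflexive (sym (+-suc _ _)))
             (≤-trans (+-monoʳ-≤ ∣ In z ∣ (x∈p⇒∣p-x∣<∣p∣ (∈-tabulate⁺ (λ y → arc G z y) ay)))
               (≤-trans (≤-reflexive (+-comm ∣ In z ∣ _)) low)))
    ... | γ , inj₁ m = γ , inj₁ λ b → m (∈-tabulate⁺ (λ y → arc G y z) b)
    ... | γ , inj₂ m = γ , inj₂ all
      where
      m′ : ∀ {u} → arc G z u ≡ true → u ≢ y → ψ u ≢ γ
      m′ b u≢y = m (x∈p∧x≢y⇒x∈p-y (∈-tabulate⁺ (λ y → arc G z y) b) u≢y)
      all : ∀ {u} → arc G z u ≡ true → ψ u ≢ γ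
      all {u} b with u ≟ y
      ... | yes refl = λ e → m′ ax x≢y (trans q e)
      ... | no u≢y = m′ b u≢y

    add-free-at : ∀ {ℓ φ X z} (e : Extension ℓ φ X) → ℓ z ≡ nothing → FreeAt (Extension.ψ e) z →
                  Extension ℓ φ (λ u → X u ⊎ u ≡ z)
    add-free-at e z0 (γ , inj₁ m) = add-free e z0 (inj₁ λ _ → m)
    add-free-at e z0 (γ , inj₂ m) = add-free e z0 (inj₂ λ _ → m)

    -- The map `ψ` is total, and the coloured vertices are those of `X`. When the head of the list
    -- is coloured, its neighbour further right is still outside `X` and imposes nothing, so a low
    -- vertex finds a colour.
    colour-towards-root : ∀ {ℓ φ r ys} {X : V → Set} → Tree r ys →
      (∀ {y} → y ∈ₗ ys → ℓ y ≡ nothing) → (∀ {y} → y ∈ₗ ys → Low y) → (∀ {y} → y ∈ₗ ys → ¬ X y) →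
      Extension ℓ φ X → Extension ℓ φ (λ u → X u ⊎ (u ∈ₗ ys × u ≢ r))
    colour-towards-root root _ _ _ e =
      restrict (λ { (inj₁ x) → x ; (inj₂ (here q , u≢r)) → contradiction q u≢r }) e
    colour-towards-root {ℓ} {φ} {r} {X = X} (graft {z} {y} {ys} t z∉ y∈ z∼y) fresh low out e =
      restrict (λ { (inj₁ x) → inj₁ (inj₁ x) ; (inj₂ (here q , _)) → inj₁ (inj₂ q)
                  ; (inj₂ (there m , ne)) → inj₂ (m , ne) })
        (colour-towards-root t (fresh ∘ there) (low ∘ there)
          (λ { m (inj₁ x) → out (there m) x ; m (inj₂ refl) → z∉ m }) e′)
      where
      e′ : Extension ℓ φ (λ u → X u ⊎ u ≡ z)
      e′ with free-colour-but-one (Extension.ψ e) (low (here refl)) z∼y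
      ... | γ , inj₁ m = add-free e (fresh (here refl)) (inj₁ λ x → m λ { refl → out (there y∈) x })
      ... | γ , inj₂ m = add-free e (fresh (here refl)) (inj₂ λ x → m λ { refl → out (there y∈) x })

    -- Used at m = ℓ u: exchanges two colours on the part b only.
    shift : Fin M → Fin c → Fin c → Maybe (Fin M) → Fin c → Fin c
    shift b s t nothing k = k
    shift b s t (just i) k with i ≟ b
    ... | yes _ = transpose s t k
    ... | no _ = k

    shift-injective : ∀ b s t m {k l} → shift b s t m k ≡ shift b s t m l → k ≡ l
    shift-injective b s t nothing e = e
    shift-injective b s t (just i) e with i ≟ b
    ... | yes _ = transpose-injective s t e
    ... | no _ = e

    Compatible : Labels → Set
    Compatible ℓ = ∀ {x y i i′} → x ∼ y → ℓ x ≡ just i → ℓ y ≡ just i′ → i ≡ i′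

    -- Within one original part, `shift` is injective, so equality of colours is kept and reflected.
    -- A tie in the merged part concerns two adjacent labelled vertices, which by `compat` share
    -- their original label.
    unmerge : ∀ {ℓ φ X} a b s t → Compatible ℓ →
              Extension (Maybe.map (redirect a b) ∘ ℓ) (λ u → shift b s t (ℓ u) (φ u)) X → Extension ℓ φ X
    unmerge {ℓ} {φ} {X} a b s t compat e = record
      { ψ = ψ ; ρ = ρ
      ; keep = λ lu lw q → keep (merged lu) (merged lw) (shifted lu lw q)
      ; reflect = λ {i} {u} {w} lu lw q → shift-injective b s t (just i)
          (subst₂ (λ m m′ → shift b s t m (φ u) ≡ shift b s t m′ (φ w)) lu lw
            (reflect (merged lu) (merged lw) q))
      ; level = λ lu lw → level (merged lu) (merged lw)
      ; climb = climb′ }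
      where
      open Extension e
      merged : ∀ {u i} → ℓ u ≡ just i → Maybe.map (redirect a b) (ℓ u) ≡ just (redirect a b i)
      merged = cong (Maybe.map (redirect a b))
      shifted : ∀ {u w i} → ℓ u ≡ just i → ℓ w ≡ just i → φ u ≡ φ w →
                shift b s t (ℓ u) (φ u) ≡ shift b s t (ℓ w) (φ w)
      shifted lu lw q = cong₂ (shift b s t) (trans lu (sym lw)) q
      unmap : ∀ m {i} → Maybe.map (redirect a b) m ≡ just i → ∃ λ k → m ≡ just k
      unmap (just k) _ = k , refl
      climb′ : ∀ {u w} → X u → X w → arc G u w ≡ true → ψ u ≡ ψ w →
               ρ u < ρ w ⊎ (∃ λ i → ℓ u ≡ just i × ℓ w ≡ just i)
      climb′ {u} {w} xu xw arcuw q with climb xu xw arcuw q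
      ... | inj₁ lt = inj₁ lt
      ... | inj₂ (_ , lu , lw) with unmap (ℓ u) lu | unmap (ℓ w) lw
      ...   | i , lu′ | i′ , lw′ with compat (inj₁ arcuw) lu′ lw′
      ...     | refl = inj₂ (i , lu′ , lw′)

    -- Tripling the levels leaves room for the offsets 0, 1 and 2 without disturbing strict
    -- inequalities.
    stretch-< : ∀ {h k m n} → h ≤ 2 → m < n → h + 3 * m < k + 3 * n
    stretch-< {h} {k} {m} {n} h≤2 m<n = begin-strict
      h + 3 * m  ≤⟨ +-monoˡ-≤ (3 * m) h≤2 ⟩
      2 + 3 * m  <⟨ n<1+n _ ⟩
      3 + 3 * m  ≡⟨ sym (*-suc 3 m) ⟩
      3 * suc m  ≤⟨ *-monoʳ-≤ 3 m<n ⟩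
      3 * n      ≤⟨ m≤n+m _ k ⟩
      k + 3 * n  ∎
      where open ≤-Reasoning

    -- If no colour is free at v, each colour occurs exactly once among the in-neighbours and
    -- once among the out-neighbours, so x and y are the only neighbours of v of their colour,
    -- and v fits on a level between them once the part of y is raised above that of x.
    bridge : ∀ {ℓ φ X v x y i i′} (e : Extension ℓ φ X) → let open Extension e in
             ℓ v ≡ nothing → Low v → ℓ x ≡ just i → ℓ y ≡ just i′ → i ≢ i′ →
             arc G x v ≡ true → arc G v y ≡ true → ψ x ≡ ψ y → ρ x ≡ ρ y →
             Extension ℓ φ (λ u → X u ⊎ u ≡ v)
    bridge {ℓ} {φ} {X} {v} {x} {y} {i} {i′} e v0 low lx ly i≢i′ axv avy ψxy ρxy
      with any? (λ x′ → ¬? (x ≟ x′) ×-dec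
                 ((arc G x′ v ≟ᵇ true) ×-dec (Extension.ψ e x ≟ Extension.ψ e x′)))
    ... | yes (x′ , x≢x′ , ax′v , q) = add-free-at e v0 (repeat-in (Extension.ψ e) low axv ax′v x≢x′ q)
    ... | no one-in
      with any? (λ y′ → ¬? (y ≟ y′) ×-dec
                 ((arc G v y′ ≟ᵇ true) ×-dec (Extension.ψ e y ≟ Extension.ψ e y′)))
    ...   | yes (y′ , y≢y′ , avy′ , q) = add-free-at e v0 (repeat-out (Extension.ψ e) low avy avy′ y≢y′ q)
    ...   | no one-out = add e v0 (ψ x) ρ′ level′
              (λ {u} {w} lt u≢v w≢v → subst₂ _<_ (sym (old u≢v)) (sym (old w≢v))
                (stretch-< {k = raise (ℓ w)} (raise≤2 (ℓ u)) lt))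
              below above
      where
      open Extension e
      raise : Maybe (Fin M) → ℕ
      raise nothing = 0
      raise (just k) with k ≟ i′
      ... | yes _ = 2
      ... | no _ = 0
      raise≤2 : ∀ m → raise m ≤ 2
      raise≤2 nothing = z≤n
      raise≤2 (just k) with k ≟ i′
      ... | yes _ = ≤-refl
      ... | no _ = z≤n
      raise-x : raise (just i) ≡ 0
      raise-x with i ≟ i′
      ... | yes q = contradiction q i≢i′
      ... | no _ = refl
      raise-y : raise (just i′) ≡ 2
      raise-y with i′ ≟ i′
      ... | yes _ = refl
      ... | no q = contradiction refl q
      stretched : V → ℕ
      stretched u = raise (ℓ u) + 3 * ρ u
      ρ′ = update v (1 + 3 * ρ x) stretched
      old : ∀ {u} → u ≢ v → ρ′ u ≡ stretched u
      old = update-other v _ stretched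
      new : ρ′ v ≡ 1 + 3 * ρ x
      new = update-same v _ stretched
      level′ : ∀ {i u w} → ℓ u ≡ just i → ℓ w ≡ just i → ρ′ u ≡ ρ′ w
      level′ lu lw = trans (old (labelled≢ v0 lu)) (trans
        (cong₂ (λ m k → raise m + 3 * k) (trans lu (sym lw)) (level lu lw)) (sym (old (labelled≢ v0 lw))))
      below : ∀ {u} → X u → u ≢ v → arc G u v ≡ true → ψ u ≡ ψ x → ρ′ u < ρ′ v
      below {u} _ u≢v a q with x ≟ u
      ... | yes refl = subst₂ _<_ (sym (trans (old u≢v) (cong (_+ 3 * ρ x) (trans (cong raise lx) raise-x))))
                       (sym new) ≤-refl
      ... | no x≢u = contradiction (u , x≢u , a , sym q) one-in
      above : ∀ {u} → X u → u ≢ v → arc G v u ≡ true → ψ u ≡ ψ x → ρ′ v < ρ′ u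
      above {u} _ u≢v a q with y ≟ u
      ... | yes refl = subst₂ _<_ (sym (trans new (cong (λ k → 1 + 3 * k) ρxy)))
                       (sym (trans (old u≢v) (cong (_+ 3 * ρ y) (trans (cong raise ly) raise-y)))) ≤-refl
      ... | no y≢u = contradiction (u , y≢u , a , trans (sym ψxy) (sym q)) one-out

    redirect-same : ∀ (a b : Fin M) → redirect a b b ≡ a
    redirect-same a b with b ≟ b
    ... | yes _ = refl
    ... | no b≢b = contradiction refl b≢b

    redirect-other : ∀ {a b i : Fin M} → i ≢ b → redirect a b i ≡ i
    redirect-other {a} {b} {i} i≢b with i ≟ b
    ... | yes e = contradiction e i≢b
    ... | no _ = refl

    -- The exchange gives `x` and `y` the same precolour inside one merged part, so they end with
    -- equal colours and equal levels. If both are out-neighbours or both in-neighbours of `v`, the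
    -- repetition frees a colour; otherwise `bridge` applies.
    finish : ∀ {ℓ φ X v x y a b} → Compatible ℓ → ℓ v ≡ nothing → Low v →
             ℓ x ≡ just a → ℓ y ≡ just b → a ≢ b → v ∼ x → v ∼ y →
             Extension (Maybe.map (redirect a b) ∘ ℓ) (λ u → shift b (φ y) (φ x) (ℓ u) (φ u)) X →
             Extension ℓ φ (λ u → X u ⊎ u ≡ v)
    finish {ℓ} {φ} {X} {v} {x} {y} {a} {b} compat v0 low lx ly a≢b v∼x v∼y e = go v∼x v∼y
      where
      open Extension e
      lx′ : Maybe.map (redirect a b) (ℓ x) ≡ just a
      lx′ = trans (cong (Maybe.map (redirect a b)) lx) (cong just (redirect-other a≢b))
      ly′ : Maybe.map (redirect a b) (ℓ y) ≡ just a
      ly′ = trans (cong (Maybe.map (redirect a b)) ly) (cong just (redirect-same a b))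
      shift-x : shift b (φ y) (φ x) (just a) (φ x) ≡ φ x
      shift-x with a ≟ b
      ... | yes q = contradiction q a≢b
      ... | no _ = refl
      shift-y : shift b (φ y) (φ x) (just b) (φ y) ≡ φ x
      shift-y with b ≟ b
      ... | yes _ = transpose-left (φ y) (φ x)
      ... | no q = contradiction refl q
      ψxy : ψ x ≡ ψ y
      ψxy = keep lx′ ly′ (trans (cong (λ m → shift b (φ y) (φ x) m (φ x)) lx)
              (trans shift-x (sym (trans (cong (λ m → shift b (φ y) (φ x) m (φ y)) ly) shift-y))))
      x≢y : x ≢ y
      x≢y refl = a≢b (just-injective (trans (sym lx) ly))
      f : Extension ℓ φ X
      f = unmerge a b (φ y) (φ x) compat e
      go : v ∼ x → v ∼ y → Extension ℓ φ (λ u → X u ⊎ u ≡ v)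
      go (inj₁ ax) (inj₁ ay) = add-free-at f v0 (repeat-out ψ low ax ay x≢y ψxy)
      go (inj₂ ax) (inj₂ ay) = add-free-at f v0 (repeat-in ψ low ax ay x≢y ψxy)
      go (inj₂ ax) (inj₁ ay) = bridge f v0 low lx ly a≢b ax ay ψxy (level lx′ ly′)
      go (inj₁ ax) (inj₂ ay) = bridge f v0 low ly lx (a≢b ∘ sym) ay ax (sym ψxy) (level ly′ lx′)

    -- A precoloured vertex z may stop being part of a when it is a source or a sink for its
    -- colour: it then moves to a level just below (h = 0) or above (h = 2) that of a.
    detach : ∀ {ℓ φ X z a γ} → ℓ z ≡ nothing → (h : ℕ) → h ≤ 2 →
             (∀ {w i} → ℓ w ≡ just i → arc G z w ≡ true → φ w ≡ γ → h < 1) →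
             (∀ {w i} → ℓ w ≡ just i → arc G w z ≡ true → φ w ≡ γ → 1 < h) →
             Extension (update z (just a) ℓ) (update z γ φ) X → Extension ℓ φ X
    detach {ℓ} {φ} {X} {z} {a} {γ} z0 h h≤2 out inn e = record
      { ψ = ψ ; ρ = ρ′
      ; keep = λ lu lw q → keep (label lu) (label lw) (trans (colour lu) (trans q (sym (colour lw))))
      ; reflect = λ lu lw q → trans (sym (colour lu)) (trans (reflect (label lu) (label lw) q) (colour lw))
      ; level = λ {_} {u} {w} lu lw → trans (old {u} (labelled≢ {ℓ} z0 lu))
          (trans (cong (λ k → 1 + 3 * k) (level (label {u} lu) (label {w} lw)))
            (sym (old {w} (labelled≢ {ℓ} z0 lw))))
      ; climb = climb′ }
      where
      open Extension e
      label : ∀ {u i} → ℓ u ≡ just i → update z (just a) ℓ u ≡ just i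
      label lu = trans (update-other z _ ℓ (labelled≢ z0 lu)) lu
      colour : ∀ {u i} → ℓ u ≡ just i → update z γ φ u ≡ φ u
      colour lu = update-other z _ φ (labelled≢ z0 lu)
      ρ′ = update z (h + 3 * ρ z) (λ u → 1 + 3 * ρ u)
      old : ∀ {u} → u ≢ z → ρ′ u ≡ 1 + 3 * ρ u
      old = update-other z _ (λ u → 1 + 3 * ρ u)
      new : ρ′ z ≡ h + 3 * ρ z
      new = update-same z _ (λ u → 1 + 3 * ρ u)
      height : ∀ u → ∃ λ k → k ≤ 2 × ρ′ u ≡ k + 3 * ρ u
      height u with u ≟ z
      ... | yes refl = h , h≤2 , refl
      ... | no _ = 1 , s≤s z≤n , refl
      climb′ : ∀ {u w} → X u → X w → arc G u w ≡ true → ψ u ≡ ψ w →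
               ρ′ u < ρ′ w ⊎ (∃ λ i → ℓ u ≡ just i × ℓ w ≡ just i)
      climb′ {u} {w} xu xw arcuw q with climb xu xw arcuw q
      ... | inj₁ lt with height u | height w
      ...   | k , k≤2 , eu | k′ , _ , ew = inj₁ (subst₂ _<_ (sym eu) (sym ew) (stretch-< {k = k′} k≤2 lt))
      climb′ {u} {w} xu xw arcuw q | inj₂ (i , lu , lw) with toSum (u ≟ z) | toSum (w ≟ z)
      ... | inj₁ refl | inj₁ refl = no-loop arcuw
      ... | inj₂ u≢z | inj₂ w≢z = inj₂ (i , trans (sym (update-other z _ ℓ u≢z)) lu ,
              trans (sym (update-other z _ ℓ w≢z)) lw)
      ... | inj₁ refl | inj₂ w≢z = inj₁ (subst₂ _<_
              (sym (trans new (cong (λ k → h + 3 * k) (level lu lw)))) (sym (old w≢z))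
              (+-monoˡ-< (3 * ρ w) (out (trans (sym (update-other z _ ℓ w≢z)) lw) arcuw
                (trans (sym (update-other z _ φ w≢z)) (trans (sym (reflect lu lw q)) (update-same z _ φ))))))
      ... | inj₂ u≢z | inj₁ refl = inj₁ (subst₂ _<_
              (sym (old u≢z)) (sym (trans new (cong (λ k → h + 3 * k) (sym (level lu lw)))))
              (+-monoˡ-< (3 * ρ u) (inn (trans (sym (update-other z _ ℓ u≢z)) lu) arcuw
                (trans (sym (update-other z _ φ u≢z)) (trans (reflect lu lw q) (update-same z _ φ))))))

    -- Eliminating the low components one at a time

    module _ {p : ℕ} where

      -- Serves as the `X` of the extensions. Unlabelled vertices of a tree removed from `J` are
      -- left to the call that removed it.
      Reached : Subset p → (Fin p → List V) → Labels → V → Set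
      Reached J T ℓ u = (∃ λ i → ℓ u ≡ just i) ⊎ (∃ λ j → j ∈ J × u ∈ₗ T j)

      -- By `touch` and `touched`, `N j` is exactly the set of parts adjacent to `T j`. The converse
      -- direction `touched` guarantees that a tree reduced to one vertex still sees two parts.
      record State (J : Subset p) (N : Fin p → Subset M) (T : Fin p → List V) (ℓ : Labels) : Set where
        field
          trees   : ∀ {j} → j ∈ J → ∃ λ r → Tree r (T j)
          fresh   : ∀ {j y} → j ∈ J → y ∈ₗ T j → ℓ y ≡ nothing
          low     : ∀ {j y} → j ∈ J → y ∈ₗ T j → Low y
          apart   : ∀ {j j′ x y} → j ∈ J → j′ ∈ J → x ∈ₗ T j → y ∈ₗ T j′ → x ≡ y ⊎ x ∼ y → j ≡ j′
          compat  : Compatible ℓ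
          touch   : ∀ {j x y i} → j ∈ J → y ∈ₗ T j → ℓ x ≡ just i → x ∼ y → i ∈ N j
          touched : ∀ {j i} → j ∈ J → i ∈ N j → ∃₂ λ x y → ℓ x ≡ just i × y ∈ₗ T j × x ∼ y

      labelled? : ∀ (m : Maybe (Fin M)) → Dec (∃ λ i → m ≡ just i)
      labelled? nothing = no λ ()
      labelled? (just i) = yes (i , refl)

      labelled-other? : ∀ (m : Maybe (Fin M)) a → Dec (∃ λ i → m ≡ just i × a ≢ i)
      labelled-other? nothing a = no λ ()
      labelled-other? (just i) a with a ≟ i
      ... | yes a≡i = no λ { (_ , refl , a≢i) → a≢i a≡i }
      ... | no a≢i = yes (i , refl , a≢i)

      -- Here `recur` is the induction hypothesis. It is general in the trees, labels and
      -- precolouring because absorbing leaves changes all three before it is applied.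
      module Elimination {J : Subset p} {N : Fin p → Subset M} {j : Fin p} (j∈J : j ∈ J)
        (merged : ∀ {a b} → a ≢ b → a ∈ N j → b ∈ N j → Sparse (J - j) (image (redirect a b) ∘ N))
        (recur : ∀ {N′ T ℓ} φ → State (J - j) N′ T ℓ → Sparse (J - j) N′ →
                 Extension ℓ φ (Reached (J - j) T ℓ))
        where

        -- The rest of `T j` is coloured while `a` and `b` are still merged, so `x` and `y` keep a
        -- common colour and level until `v`, the new root, is coloured last.
        commit : ∀ {T ℓ v x y a b} φ → State J N T ℓ → v ∈ₗ T j → v ∼ x → v ∼ y →
                 ℓ x ≡ just a → ℓ y ≡ just b → a ≢ b → Extension ℓ φ (Reached J T ℓ)
        commit {T} {ℓ} {v} {x} {y} {a} {b} φ st v∈ v∼x v∼y lx ly a≢b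
          with reroot (proj₂ (State.trees st j∈J)) v∈
        ... | rerooted tree to from = restrict split
                (finish compat (fresh j∈J v∈) (low j∈J v∈) lx ly a≢b v∼x v∼y
                  (colour-towards-root tree (fresh′ j∈J ∘ from) (low j∈J ∘ from) (outside ∘ from)
                    (recur _ st′ (merged a≢b (touch j∈J v∈ lx (∼-sym v∼x)) (touch j∈J v∈ ly (∼-sym v∼y))))))
          where
          open State st
          f = redirect a b
          ℓ′ = Maybe.map f ∘ ℓ
          J⊆ : J - j ⊆ J
          J⊆ = p─q⊆p J ⁅ j ⁆
          fresh′ : ∀ {j y} → j ∈ J → y ∈ₗ T j → ℓ′ y ≡ nothing
          fresh′ j∈ y∈ = cong (Maybe.map f) (fresh j∈ y∈)
          unmap : ∀ m {i} → Maybe.map f m ≡ just i → ∃ λ k → m ≡ just k × f k ≡ i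
          unmap (just k) refl = k , refl , refl
          st′ : State (J - j) (image f ∘ N) T ℓ′
          st′ = record
            { trees = λ j′∈ → trees (J⊆ j′∈)
            ; fresh = λ j′∈ → fresh′ (J⊆ j′∈)
            ; low = λ j′∈ → low (J⊆ j′∈)
            ; apart = λ m m′ → apart (J⊆ m) (J⊆ m′)
            ; compat = λ {x} {y} x∼y lx ly → case (unmap (ℓ x) lx , unmap (ℓ y) ly) of λ
                { ((k , lx , fk) , (k′ , ly , fk′)) → trans (sym fk) (trans (cong f (compat x∼y lx ly)) fk′) }
            ; touch = λ {_} {x} j′∈ y∈ lx x∼y → case unmap (ℓ x) lx of λ
                { (k , lx , refl) → ∈-image⁺ f (touch (J⊆ j′∈) y∈ lx x∼y) }
            ; touched = λ j′∈ i∈ → case ∈-image⁻ f i∈ of λ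
                { (k , k∈ , refl) → case touched (J⊆ j′∈) k∈ of λ
                  { (x , y , lx , rest) → x , y , cong (Maybe.map f) lx , rest } }
            }
          outside : ∀ {y} → y ∈ₗ T j → ¬ Reached (J - j) T ℓ′ y
          outside y∈ (inj₁ (i , ly)) = case trans (sym (fresh′ j∈J y∈)) ly of λ ()
          outside y∈ (inj₂ (j′ , j′∈ , y∈′)) =
            x∉p-x J j (subst (_∈ J - j) (sym (apart j∈J (J⊆ j′∈) y∈ y∈′ (inj₁ refl))) j′∈)
          split : ∀ {u} → Reached J T ℓ u → (Reached (J - j) T ℓ′ u ⊎ (u ∈ₗ _ × u ≢ v)) ⊎ u ≡ v
          split (inj₁ (i , lu)) = inj₁ (inj₁ (inj₁ (f i , cong (Maybe.map f) lu)))
          split {u} (inj₂ (j′ , j′∈ , u∈)) with j′ ≟ j | u ≟ v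
          ... | _ | yes e = inj₂ e
          ... | yes refl | no u≢v = inj₁ (inj₂ (to u∈ , u≢v))
          ... | no j′≢j | no _ = inj₁ (inj₁ (inj₂ (j′ , x∈p∧x≢y⇒x∈p-y j′∈ j′≢j , u∈)))

        -- The family `N` does not change. A contact of `T j` made through `z` can only be with the
        -- part `a`, and is replaced by the contact of `z`, now in that part, with `y₀`. Other trees
        -- are not adjacent to `z` by `apart`.
        absorb-leaf : ∀ {T ℓ z y ys r a} → State J N T ℓ → T j ≡ z ∷ ys → Tree r ys →
                      z ∉ₗ ys → y ∈ₗ ys → z ∼ y → a ∈ N j → (∀ {x i} → z ∼ x → ℓ x ≡ just i → i ≡ a) →
                      State J N (update j ys T) (update z (just a) ℓ)
        absorb-leaf {T} {ℓ} {z} {y₀} {ys} {r} {a} st eq t z∉ y₀∈ z∼y₀ a∈ only = record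
          { trees = trees′
          ; fresh = λ j′∈ u∈ → trans (update-other z _ ℓ (avoids j′∈ u∈)) (fresh j′∈ (sub u∈))
          ; low = λ j′∈ u∈ → low j′∈ (sub u∈)
          ; apart = λ m m′ x∈ y∈ → apart m m′ (sub x∈) (sub y∈)
          ; compat = λ x∼y lx ly → compat′ x∼y (unlabel lx) (unlabel ly)
          ; touch = λ j′∈ y∈ lx x∼y → touch′ j′∈ y∈ (unlabel lx) x∼y
          ; touched = touched′ }
          where
          open State st
          ℓ′ = update z (just a) ℓ
          T′ = update j ys T
          z∈ : z ∈ₗ T j
          z∈ = subst (z ∈ₗ_) (sym eq) (here refl)
          sub : ∀ {u j′} → u ∈ₗ T′ j′ → u ∈ₗ T j′
          sub {u} {j′} u∈ with j′ ≟ j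
          ... | yes refl = subst (u ∈ₗ_) (sym eq) (there u∈)
          ... | no _ = u∈
          avoids : ∀ {u j′} → j′ ∈ J → u ∈ₗ T′ j′ → u ≢ z
          avoids {j′ = j′} j′∈ u∈ refl with j′ ≟ j
          ... | yes refl = z∉ u∈
          ... | no j′≢j = j′≢j (apart j′∈ j∈J u∈ z∈ (inj₁ refl))
          super : ∀ {u j′} → u ∈ₗ T j′ → u ≢ z → u ∈ₗ T′ j′
          super {u} {j′} u∈ u≢z with j′ ≟ j
          ... | no _ = u∈
          ... | yes refl with subst (u ∈ₗ_) eq u∈
          ...   | here e = contradiction e u≢z
          ...   | there m = m
          trees′ : ∀ {j′} → j′ ∈ J → ∃ λ r → Tree r (T′ j′)
          trees′ {j′} j′∈ with j′ ≟ j
          ... | yes refl = r , t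
          ... | no _ = trees j′∈
          unlabel : ∀ {u i} → ℓ′ u ≡ just i → (u ≡ z × i ≡ a) ⊎ ℓ u ≡ just i
          unlabel {u} lu with u ≟ z
          ... | yes e = inj₁ (e , sym (just-injective lu))
          ... | no _ = inj₂ lu
          compat′ : ∀ {x y i i′} → x ∼ y → (x ≡ z × i ≡ a) ⊎ ℓ x ≡ just i →
                    (y ≡ z × i′ ≡ a) ⊎ ℓ y ≡ just i′ → i ≡ i′
          compat′ x∼y (inj₁ (_ , refl)) (inj₁ (_ , refl)) = refl
          compat′ x∼y (inj₁ (refl , refl)) (inj₂ ly) = sym (only x∼y ly)
          compat′ x∼y (inj₂ lx) (inj₁ (refl , refl)) = only (∼-sym x∼y) lx
          compat′ x∼y (inj₂ lx) (inj₂ ly) = compat x∼y lx ly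
          touch′ : ∀ {j′ x y i} → j′ ∈ J → y ∈ₗ T′ j′ → (x ≡ z × i ≡ a) ⊎ ℓ x ≡ just i → x ∼ y → i ∈ N j′
          touch′ j′∈ y∈ (inj₂ lx) x∼y = touch j′∈ (sub y∈) lx x∼y
          touch′ j′∈ y∈ (inj₁ (refl , refl)) x∼y with apart j∈J j′∈ z∈ (sub y∈) (inj₂ x∼y)
          ... | refl = a∈
          touched′ : ∀ {j′ i} → j′ ∈ J → i ∈ N j′ → ∃₂ λ x y → ℓ′ x ≡ just i × y ∈ₗ T′ j′ × x ∼ y
          touched′ j′∈ i∈ with touched j′∈ i∈
          ... | x , y , lx , y∈ , x∼y with y ≟ z
          ...   | no y≢z = x , y , trans (update-other z _ ℓ (labelled≢ {ℓ} (fresh j∈J z∈) lx)) lx ,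
                          super y∈ y≢z , x∼y
          ...   | yes refl with apart j∈J j′∈ z∈ y∈ (inj₁ refl) | only (∼-sym x∼y) lx
          ...     | refl | refl = z , y₀ , update-same z _ ℓ , subst (y₀ ∈ₗ_) (sym (update-same j ys T)) y₀∈ , z∼y₀

        -- The colour `γ` of `z` is fixed before the rest of the tree is treated, so that later
        -- permutations of the part `a` carry `z` along. Ignoring `y` in the choice is harmless: `y`
        -- is unlabelled, and the arcs between `z` and the rest of the tree are settled by the
        -- extension `e`.
        absorb-then : ∀ {T ℓ z y ys r a} →
          (∀ {T ℓ} φ → T j ≡ ys → State J N T ℓ → Extension ℓ φ (Reached J T ℓ)) →
          ∀ φ → T j ≡ z ∷ ys → State J N T ℓ → Tree r ys → z ∉ₗ ys → y ∈ₗ ys → z ∼ y →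
          a ∈ N j → (∀ {x i} → z ∼ x → ℓ x ≡ just i → i ≡ a) → Extension ℓ φ (Reached J T ℓ)
        absorb-then {T} {ℓ} {z} {y} {ys} {a = a} continue φ eq st t z∉ y∈ z∼y a∈ only
          with free-colour-but-one φ (State.low st j∈J (subst (z ∈ₗ_) (sym eq) (here refl))) z∼y
        ... | γ , free = detached free
          where
          open State st
          z∈ : z ∈ₗ T j
          z∈ = subst (z ∈ₗ_) (sym eq) (here refl)
          y0 : ℓ y ≡ nothing
          y0 = fresh j∈J (subst (y ∈ₗ_) (sym eq) (there y∈))
          reached : ∀ {u} → Reached J T ℓ u → Reached J (update j ys T) (update z (just a) ℓ) u
          reached (inj₁ (i , lu)) = inj₁ (i , trans (update-other z _ ℓ (labelled≢ {ℓ} (fresh j∈J z∈) lu)) lu)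
          reached {u} (inj₂ (j′ , j′∈ , u∈)) with j′ ≟ j
          ... | no j′≢j = inj₂ (j′ , j′∈ , subst (u ∈ₗ_) (sym (update-other j ys T j′≢j)) u∈)
          ... | yes refl with subst (u ∈ₗ_) eq u∈
          ...   | here refl = inj₁ (a , update-same z _ ℓ)
          ...   | there m = inj₂ (j , j∈J , subst (u ∈ₗ_) (sym (update-same j ys T)) m)
          e : Extension (update z (just a) ℓ) (update z γ φ) (Reached J T ℓ)
          e = restrict reached (continue _ (update-same j ys T) (absorb-leaf st eq t z∉ y∈ z∼y a∈ only))
          detached : (∀ {u} → u ≢ y → arc G u z ≡ true → φ u ≢ γ) ⊎
                     (∀ {u} → u ≢ y → arc G z u ≡ true → φ u ≢ γ) →
                     Extension ℓ φ (Reached J T ℓ)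
          detached (inj₁ m) = detach (fresh j∈J z∈) 0 z≤n (λ _ _ _ → s≤s z≤n)
            (λ lw a q → contradiction q (m (labelled≢ {ℓ} y0 lw) a)) e
          detached (inj₂ m) = detach (fresh j∈J z∈) 2 ≤-refl
            (λ lw a q → contradiction q (m (labelled≢ {ℓ} y0 lw) a)) (λ _ _ _ → s≤s (s≤s z≤n)) e

        -- Absorption preserves `N`, so `a` and `b` stay in `N j`. If no earlier vertex sees two
        -- parts, the root is finally alone and sees both by `touched`; hence `commit` is always
        -- reached.
        absorb : ∀ {r ys a b} → a ≢ b → a ∈ N j → b ∈ N j → Tree r ys →
                 ∀ {T ℓ} φ → T j ≡ ys → State J N T ℓ → Extension ℓ φ (Reached J T ℓ)
        absorb a≢b a∈ b∈ root {T} φ eq st with State.touched st j∈J a∈ | State.touched st j∈J b∈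
        ... | x , y , lx , y∈ , x∼y | x′ , y′ , lx′ , y′∈ , x′∼y′
          with subst (y ∈ₗ_) eq y∈ | subst (y′ ∈ₗ_) eq y′∈
        ...   | here refl | here refl = commit φ st y∈ (∼-sym x∼y) (∼-sym x′∼y′) lx lx′ a≢b
        absorb a≢b a∈ b∈ (graft {z} {y} {ys} t z∉ y∈ z∼y) {T} {ℓ} φ eq st
          with any? (λ x → (z ∼? x) ×-dec labelled? (ℓ x))
        -- This leaf sees no part at all, so it may join any part of `N j`; `a` is chosen.
        ... | no none = absorb-then (absorb a≢b a∈ b∈ t) φ eq st t z∉ y∈ z∼y a∈
                          λ z∼x lx → contradiction (_ , z∼x , _ , lx) none
        ... | yes (x , z∼x , i , lx) with any? (λ x′ → (z ∼? x′) ×-dec labelled-other? (ℓ x′) i)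
        ...   | yes (x′ , z∼x′ , i′ , lx′ , i≢i′) = commit φ st z∈ z∼x z∼x′ lx lx′ i≢i′
          where
          z∈ : z ∈ₗ T j
          z∈ = subst (z ∈ₗ_) (sym eq) (here refl)
        ...   | no none = absorb-then (absorb a≢b a∈ b∈ t) φ eq st t z∉ y∈ z∼y
                            (State.touch st j∈J (subst (z ∈ₗ_) (sym eq) (here refl)) lx (∼-sym z∼x))
                            λ {_} {i′} z∼x′ lx′ → decidable-stable (i′ ≟ i) λ i′≢i →
                              none (_ , z∼x′ , i′ , lx′ , i′≢i ∘ sym)

      solve : ∀ m {J N T ℓ} φ → ∣ J ∣ ≤ m → Fin M → State J N T ℓ → Sparse J N → Extension ℓ φ (Reached J T ℓ)
      solve m {J} φ J≤m i₀ st sparse with nonempty? J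
      -- No tree is left, so every reached vertex is labelled. Every arc between two of them lies
      -- inside one part by `compat`, and constant levels suffice.
      solve m φ J≤m i₀ st sparse | no empty = record
        { ψ = φ ; ρ = λ _ → 0 ; keep = λ _ _ q → q ; reflect = λ _ _ q → q ; level = λ _ _ → refl
        ; climb = λ { (inj₁ (i , lu)) (inj₁ (i′ , lw)) a _ →
                      inj₂ (i , lu , trans lw (cong just (sym (State.compat st (inj₁ a) lu lw))))
                    ; (inj₂ (j , j∈ , _)) _ _ _ → contradiction (j , j∈) empty
                    ; (inj₁ _) (inj₂ (j , j∈ , _)) _ _ → contradiction (j , j∈) empty } }
      solve zero φ J≤m i₀ st sparse | yes (j , j∈) = contradiction (≤-trans (x∈p⇒0<∣p∣ j∈) J≤m) λ ()
      solve (suc m) φ J≤m i₀ st sparse | yes nonempty with mergeable sparse nonempty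
      ... | j , j∈ , merged with sparse⇒two sparse i₀ j∈ | State.trees st j∈
      ...   | a , b , a≢b , a∈ , b∈ | r , t =
        Elimination.absorb j∈ merged
          (λ φ → solve m φ (s≤s⁻¹ (≤-trans (x∈p⇒∣p-x∣<∣p∣ j∈) J≤m)) i₀) a≢b a∈ b∈ t φ refl st

  -- The system of parts and low components of a digraph

  record SpanningTree (X : Subset (n G)) (r : V) : Set where
    field
      {list} : List V
      tree   : Tree r list
      within : ∀ {u} → u ∈ₗ list → u ∈ X
      closed : ∀ {y z} → y ∈ₗ list → z ∈ X → z ∼ y → z ∈ₗ list

    connected⇒∈ : ∀ {y z} → y ∈ₗ list → ConnectedIn G X y z → z ∈ₗ list
    connected⇒∈ y∈ ε = y∈
    connected⇒∈ y∈ ((_ , z∈ , y∼z) ◅ path) = connected⇒∈ (closed y∈ z∈ (∼-sym y∼z)) path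

  spanning-tree : ∀ {X r} → r ∈ X → SpanningTree X r
  spanning-tree {X} {r} r∈X = grow (∣ X ∣) X ≤-refl root (λ { (here refl) → r∈X }) (λ u∈ _ → u∈)
    where
    -- `R` contains the vertices of `X` not yet in the tree, so its size bounds the number of grafts
    -- to come.
    grow : ∀ m (R : Subset (n G)) {ys} → ∣ R ∣ ≤ m → Tree r ys → (∀ {u} → u ∈ₗ ys → u ∈ X) →
           (∀ {u} → u ∈ X → u ∉ₗ ys → u ∈ R) → SpanningTree X r
    grow m R {ys} R≤m t within rest
      with any? (λ z → (z ∈? X) ×-dec (¬? (∈ₗ? _≟_ z ys) ×-dec
                  any? (λ y → ∈ₗ? _≟_ y ys ×-dec (z ∼? y))))
    ... | no none = record
      { tree = t ; within = within
      ; closed = λ {y} {z} y∈ z∈ z∼y → case ∈ₗ? _≟_ z ys of λ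
          { (yes z∈ys) → z∈ys ; (no z∉ys) → contradiction (z , z∈ , z∉ys , y , y∈ , z∼y) none } }
    grow zero R R≤m t within rest | yes (z , z∈ , z∉ , _) =
      contradiction (≤-trans (x∈p⇒0<∣p∣ (rest z∈ z∉)) R≤m) λ ()
    grow (suc m) R R≤m t within rest | yes (z , z∈ , z∉ , y , y∈ , z∼y) =
      grow m (R - z) (s≤s⁻¹ (≤-trans (x∈p⇒∣p-x∣<∣p∣ (rest z∈ z∉)) R≤m)) (graft t z∉ y∈ z∼y)
        (λ { (here refl) → z∈ ; (there m) → within m })
        (λ u∈ u∉ → x∈p∧x≢y⇒x∈p-y (rest u∈ (u∉ ∘ there)) (u∉ ∘ here))

  -- From an extension to a dicolouring of the whole digraph

  module Assemble {M c} (default : Fin c) (ℓ : V → Maybe (Fin M))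
    (colour-proper : ∀ (H : Subdigraph G) → Proper H → Dicolourable H c)
    (not-all : ∀ i → ∃ λ v → ℓ v ≢ just i) where

    private
      _≟ₘ_ : (a b : Maybe (Fin M)) → Dec (a ≡ b)
      _≟ₘ_ = ≡-dec _≟_

      inner? : ∀ i x y → Dec (arc G x y ≡ true × ℓ x ≡ just i × ℓ y ≡ just i)
      inner? i x y = (arc G x y ≟ᵇ true) ×-dec ((ℓ x ≟ₘ just i) ×-dec (ℓ y ≟ₘ just i))

    part : Fin M → Subdigraph G
    part i = record
      { verts = comprehension (λ x → ℓ x ≟ₘ just i)
      ; arcs  = λ x y → does (inner? i x y)
      ; arcs⊆ = λ x y e → case does⁻ (inner? i x y) e of λ
          { (a , lx , ly) → ∈-comprehension⁺ (λ x → ℓ x ≟ₘ just i) lx ,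
                            ∈-comprehension⁺ (λ x → ℓ x ≟ₘ just i) ly , a } }

    part-proper : ∀ i → Proper (part i)
    part-proper i (e , _) with not-all i
    ... | v , lv = lv (∈-comprehension⁻ (λ x → ℓ x ≟ₘ just i) (subst (v ∈_) (sym e) ∈⊤))

    part-colouring : ∀ i → Dicolourable (part i) c
    part-colouring i = colour-proper (part i) (part-proper i)

    choose : Maybe (Fin M) → V → Fin c
    -- Any colour will do, since an `Extension` constrains the precolouring only at labelled
    -- vertices.
    choose nothing _ = default
    choose (just i) = proj₁ (part-colouring i)

    φ : V → Fin c
    φ u = choose (ℓ u) u

    open Colouring {c} {M}

    whole-dicolourable : ∀ {X} → (∀ u → X u) → Extension ℓ φ X → Dicolourable (whole G) c
    whole-dicolourable all e = ψ , λ γ x walk → case analyse γ walk of λ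
      { (inj₁ lt) → n≮n _ lt
      ; (inj₂ (i , _ , _ , _ , inner)) → proj₂ (part-colouring i) _ x (inner _ refl) }
      where
      open Extension e
      Step : Fin c → V → V → Set
      Step γ u v = arc G u v ≡ true × ψ u ≡ γ × ψ v ≡ γ
      InnerStep : Fin M → Fin c → V → V → Set
      InnerStep i κ u v = arcs (part i) u v ≡ true × choose (just i) u ≡ κ × choose (just i) v ≡ κ
      -- A walk inside one part. Its colour `κ` in the colouring of that part may differ from its
      -- colour under `ψ`. The labels of both ends are recorded so that levels agree and a strict
      -- ascent elsewhere survives concatenation.
      Inner : V → V → Set
      Inner x y = ∃ λ i → ℓ x ≡ just i × ℓ y ≡ just i × choose (just i) x ≡ choose (just i) y ×
        (∀ κ → choose (just i) x ≡ κ → TransClosure (InnerStep i κ) x y)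
      step : ∀ γ {x y} → Step γ x y → ρ x < ρ y ⊎ Inner x y
      step γ {x} {y} (a , ex , ey) with climb (all x) (all y) a (trans ex (sym ey))
      ... | inj₁ lt = inj₁ lt
      ... | inj₂ (i , lx , ly) = inj₂ (i , lx , ly , same , λ κ q →
              [ dec-true (inner? i x y) (a , lx , ly) , q , trans (sym same) q ])
        where
        same : choose (just i) x ≡ choose (just i) y
        same = subst₂ (λ m m′ → choose m x ≡ choose m′ y) lx ly (reflect lx ly (trans ex (sym ey)))
      analyse : ∀ γ {x y} → TransClosure (Step γ) x y → ρ x < ρ y ⊎ Inner x y
      analyse γ [ s ] = step γ s
      analyse γ (s ∷ walk) with step γ s | analyse γ walk
      ... | inj₁ lt | inj₁ lt′ = inj₁ (<-trans lt lt′)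
      ... | inj₁ lt | inj₂ (_ , ly , lz , _) = inj₁ (<-≤-trans lt (≤-reflexive (level ly lz)))
      ... | inj₂ (_ , lx , ly , _) | inj₁ lt = inj₁ (≤-<-trans (≤-reflexive (level lx ly)) lt)
      ... | inj₂ (i , lx , ly , same , w) | inj₂ (i′ , ly′ , lz , same′ , w′) with trans (sym ly) ly′
      ...   | refl = inj₂ (i , lx , lz , trans same same′ , λ κ q → w κ q ++⁺ w′ κ (trans (sym same) q))

  -- `J₀` need not be all of `Fin p`: an empty `L` counts as one component by convention, but
  -- contributes no index.
  module Start {c : ℕ} (default : Fin c)
    (colour-proper : ∀ (H : Subdigraph G) → Proper H → Dicolourable H c)
    (L : Subset (n G)) (low : ∀ {x} → x ∈ L → deg G x ≤ c + c)
    {q p : ℕ} (2≤q : 2 ≤ q) (f₁ : V → Fin q) (f₂ : V → Fin p) (J₀ : Subset p) (few : ∣ J₀ ∣ < q)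
    (high-adjacent : ∀ {x y} → x ∉ L → y ∉ L → x ∼ y → f₁ x ≡ f₁ y)
    (high-onto : ∀ i → ∃ λ x → x ∉ L × f₁ x ≡ i)
    (low-connected : ∀ {x y} → x ∈ L → y ∈ L → f₂ x ≡ f₂ y → ConnectedIn G L x y)
    (low-adjacent : ∀ {x y} → x ∈ L → y ∈ L → x ∼ y → f₂ x ≡ f₂ y)
    (low-onto : ∀ {j} → j ∈ J₀ → ∃ λ x → x ∈ L × f₂ x ≡ j)
    (low-index : ∀ {x} → x ∈ L → f₂ x ∈ J₀)
    where

    private
      Joins : Fin p → Fin q → Set
      Joins j i = ∃ λ x → (x ∉ L × f₁ x ≡ i) × (∃ λ y → (y ∈ L × f₂ y ≡ j) × x ∼ y)

      joins? : ∀ j i → Dec (Joins j i)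
      joins? j i = any? (λ x → (¬? (x ∈? L) ×-dec (f₁ x ≟ i)) ×-dec
                     any? (λ y → ((y ∈? L) ×-dec (f₂ y ≟ j)) ×-dec (x ∼? y)))

    -- J₀ indexes the components of G[L], N₀ j is the set of components of G − L adjacent to
    -- the j-th one, and contract sends the parts in I₀ to a single new label zero.
    abstract
      N₀ : Fin p → Subset q
      N₀ j = comprehension (joins? j)

      ∈-N₀⁺ : ∀ {i j} → Joins j i → i ∈ N₀ j
      ∈-N₀⁺ {i} {j} = ∈-comprehension⁺ (joins? j)

      ∈-N₀⁻ : ∀ {i j} → i ∈ N₀ j → Joins j i
      ∈-N₀⁻ {i} {j} = ∈-comprehension⁻ (joins? j)

    private
      Dense : Subset q → Set
      Dense I = ∣ I ∣ ≤ ∣ enclosed J₀ N₀ I ∣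

      dense? : ∀ I → Dec (Dense I)
      dense? I = ∣ I ∣ ≤? ∣ enclosed J₀ N₀ I ∣

      largest : ∃ λ I → Dense I × (∀ K → Dense K → q ∸ ∣ I ∣ ≤ q ∸ ∣ K ∣)
      -- The empty set is dense, and minimising `q ∸ ∣ I ∣` maximises `∣ I ∣`.
      largest = least dense? (λ I → q ∸ ∣ I ∣) (∅ , ≤-trans (≤-reflexive (∣⊥∣≡0 q)) z≤n)

      I₀ : Subset q
      I₀ = proj₁ largest

      I₀-dense : Dense I₀
      I₀-dense = proj₁ (proj₂ largest)

      larger-sparse : ∀ K → ∣ I₀ ∣ < ∣ K ∣ → ∣ enclosed J₀ N₀ K ∣ < ∣ K ∣
      larger-sparse K I₀<K = ≰⇒> λ dense → <⇒≱ I₀<K (∸-cancelʳ-≤ (∣p∣≤n K) (proj₂ (proj₂ largest) K dense))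

      A : Subset p
      A = enclosed J₀ N₀ I₀

      A⊆J₀ : A ⊆ J₀
      A⊆J₀ = proj₁ ∘ ∈-enclosed⁻

      -- Here the assumption of more parts than low components enters: if `I₀` held all q parts,
      -- density would require q indices in `J₀`.
      missing : ∃ λ i → i ∉ I₀
      missing with any? (λ i → ¬? (i ∈? I₀))
      ... | yes i = i
      ... | no all = contradiction
              (≤-trans (≤-trans (≤-reflexive (sym (∣⊤∣≡n q))) (p⊆q⇒∣p∣≤∣q∣ full))
                (≤-trans I₀-dense (p⊆q⇒∣p∣≤∣q∣ A⊆J₀))) (<⇒≱ few)
        where
        full : ⊤ ⊆ I₀
        full {i} _ = case i ∈? I₀ of λ { (yes i∈) → i∈ ; (no i∉) → contradiction (i , i∉) all }

      J : Subset p
      J = J₀ ∩ ∁ A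

      J⁻ : ∀ {j} → j ∈ J → j ∈ J₀ × j ∉ A
      J⁻ j∈ = let (a , b) = x∈p∩q⁻ J₀ (∁ A) j∈ in a , x∈∁p⇒x∉p b

      contract : Fin q → Fin (suc q)
      contract i with i ∈? I₀
      ... | yes _ = zero
      ... | no _ = suc i

      contract-∈ : ∀ {i} → i ∈ I₀ → contract i ≡ zero
      contract-∈ {i} i∈ with i ∈? I₀
      ... | yes _ = refl
      ... | no i∉ = contradiction i∈ i∉

      contract-∉ : ∀ {i} → i ∉ I₀ → contract i ≡ suc i
      contract-∉ {i} i∉ with i ∈? I₀
      ... | yes i∈ = contradiction i∈ i∉
      ... | no _ = refl

      N : Fin p → Subset (suc q)
      N j = image contract (N₀ j)

      ℓ : V → Maybe (Fin (suc q))
      ℓ x with x ∈? L | f₂ x ∈? A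
      ... | yes _ | yes _ = just zero
      ... | yes _ | no _ = nothing
      ... | no _ | _ = just (contract (f₁ x))

      ℓ-high : ∀ {x} → x ∉ L → ℓ x ≡ just (contract (f₁ x))
      ℓ-high {x} x∉ with x ∈? L | f₂ x ∈? A
      ... | yes x∈ | _ = contradiction x∈ x∉
      ... | no _ | _ = refl

      ℓ-low : ∀ {x} → x ∈ L → f₂ x ∉ A → ℓ x ≡ nothing
      ℓ-low {x} x∈ f∉ with x ∈? L | f₂ x ∈? A
      ... | yes _ | yes f∈ = contradiction f∈ f∉
      ... | yes _ | no _ = refl
      ... | no x∉ | _ = contradiction x∈ x∉

      ℓ-absorbed : ∀ {x} → x ∈ L → f₂ x ∈ A → ℓ x ≡ just zero
      ℓ-absorbed {x} x∈ f∈ with x ∈? L | f₂ x ∈? A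
      ... | yes _ | yes _ = refl
      ... | yes _ | no f∉ = contradiction f∈ f∉
      ... | no x∉ | _ = contradiction x∈ x∉

      data Kind (x : V) : Fin (suc q) → Set where
        absorbed : x ∈ L → f₂ x ∈ A → Kind x zero
        high     : x ∉ L → Kind x (contract (f₁ x))

      kind : ∀ {x i} → ℓ x ≡ just i → Kind x i
      kind {x} e with x ∈? L | f₂ x ∈? A
      kind refl | yes x∈ | yes f∈ = absorbed x∈ f∈
      kind refl | no x∉ | _ = high x∉

    -- Makes every label class proper, hence c-dicolourable by criticality. The class `zero` omits a
    -- part outside `I₀`, and the class `suc i` omits any part other than `i`, which exists as
    -- `2 ≤ q`.
    not-all : ∀ i → ∃ λ v → ℓ v ≢ just i
    not-all zero with missing
    ... | i , i∉ with high-onto i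
    ...   | v , v∉ , refl = v , λ e →
              case trans (sym (cong just (contract-∉ i∉))) (trans (sym (ℓ-high v∉)) e) of λ ()
    not-all (suc i) with another 2≤q i
      where
      another : ∀ {m} → 2 ≤ m → (i : Fin m) → ∃ λ i′ → i′ ≢ i
      another (s≤s (s≤s _)) zero = suc zero , λ ()
      another (s≤s (s≤s _)) (suc i) = zero , λ ()
    ... | i′ , i′≢i with high-onto i′
    ...   | v , v∉ , refl = v , λ e → differ (just-injective (trans (sym (ℓ-high v∉)) e))
      where
      differ : contract (f₁ v) ≢ suc i
      differ e with f₁ v ∈? I₀
      differ () | yes _
      differ refl | no _ = i′≢i refl

    private
      T-all : ∀ j → ∃ λ ys → j ∈ J₀ → (∃ λ r → Tree r ys) × (∀ {u} → u ∈ₗ ys → u ∈ L × f₂ u ≡ j) ×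
                (∀ {u} → u ∈ L → f₂ u ≡ j → u ∈ₗ ys)
      T-all j with j ∈? J₀
      ... | no j∉ = [] , λ j∈ → contradiction j∈ j∉
      ... | yes j∈ with low-onto j∈
      ...   | r , r∈ , refl = list , λ _ → (r , tree) , (λ u∈ → within u∈ , same tree within u∈) ,
                λ u∈ e → connected⇒∈ (root∈ tree) (low-connected r∈ u∈ (sym e))
        where
        open SpanningTree (spanning-tree r∈)
        same : ∀ {ys} → Tree r ys → (∀ {u} → u ∈ₗ ys → u ∈ L) → ∀ {u} → u ∈ₗ ys → f₂ u ≡ f₂ r
        same root _ (here refl) = refl
        same (graft t _ y∈ z∼y) w (here refl) =
          trans (low-adjacent (w (here refl)) (w (there y∈)) z∼y) (same t (w ∘ there) y∈)
        same (graft t _ _ _) w (there u∈) = same t (w ∘ there) u∈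

      T′ : Fin p → List V
      T′ j = proj₁ (T-all j)

      trees : ∀ {j} → j ∈ J → ∃ λ r → Tree r (T′ j)
      trees {j} j∈ = proj₁ (proj₂ (T-all j) (proj₁ (J⁻ j∈)))

      T⁻ : ∀ {j u} → j ∈ J → u ∈ₗ T′ j → u ∈ L × f₂ u ≡ j
      T⁻ {j} j∈ = proj₁ (proj₂ (proj₂ (T-all j) (proj₁ (J⁻ j∈))))

      T⁺ : ∀ {j u} → j ∈ J → u ∈ L → f₂ u ≡ j → u ∈ₗ T′ j
      T⁺ {j} j∈ = proj₂ (proj₂ (proj₂ (T-all j) (proj₁ (J⁻ j∈))))

      neighbour-part : ∀ {x y} → x ∉ L → y ∈ L → x ∼ y → f₁ x ∈ N₀ (f₂ y)
      neighbour-part x∉ y∈ x∼y = ∈-N₀⁺ (_ , (x∉ , refl) , _ , (y∈ , refl) , x∼y)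

      absorbed-part : ∀ {x y} → x ∉ L → y ∈ L → f₂ y ∈ A → x ∼ y → contract (f₁ x) ≡ zero
      absorbed-part x∉ y∈ f∈ x∼y = contract-∈ (proj₂ (∈-enclosed⁻ f∈) (neighbour-part x∉ y∈ x∼y))

      open Colouring {c} {suc q}

      state : State J N T′ ℓ
      state = record
        { trees = trees
        ; fresh = λ j∈ y∈ → case T⁻ j∈ y∈ of λ { (y∈L , refl) → ℓ-low y∈L (proj₂ (J⁻ j∈)) }
        ; low = λ j∈ y∈ → low (proj₁ (T⁻ j∈ y∈))
        ; apart = λ j∈ j′∈ x∈ y∈ → case (T⁻ j∈ x∈ , T⁻ j′∈ y∈) of λ
            { ((x∈L , refl) , (y∈L , refl)) →
                λ { (inj₁ refl) → refl ; (inj₂ x∼y) → low-adjacent x∈L y∈L x∼y } }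
        ; compat = λ x∼y lx ly → compat x∼y (kind lx) (kind ly)
        ; touch = λ j∈ y∈ lx x∼y → touch j∈ (T⁻ j∈ y∈) (kind lx) x∼y
        ; touched = touched }
        where
        compat : ∀ {x y i i′} → x ∼ y → Kind x i → Kind y i′ → i ≡ i′
        compat x∼y (absorbed _ _) (absorbed _ _) = refl
        compat x∼y (absorbed x∈ f∈) (high y∉) = sym (absorbed-part y∉ x∈ f∈ (∼-sym x∼y))
        compat x∼y (high x∉) (absorbed y∈ f∈) = absorbed-part x∉ y∈ f∈ x∼y
        compat x∼y (high x∉) (high y∉) = cong contract (high-adjacent x∉ y∉ x∼y)
        touch : ∀ {j x y i} → j ∈ J → y ∈ L × f₂ y ≡ j → Kind x i → x ∼ y → i ∈ N j
        touch j∈ (y∈ , refl) (absorbed x∈ f∈) x∼y =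
          contradiction (subst (_∈ A) (low-adjacent x∈ y∈ x∼y) f∈) (proj₂ (J⁻ j∈))
        touch j∈ (y∈ , refl) (high x∉) x∼y = ∈-image⁺ contract (neighbour-part x∉ y∈ x∼y)
        touched : ∀ {j i} → j ∈ J → i ∈ N j → ∃₂ λ x y → ℓ x ≡ just i × y ∈ₗ T′ j × x ∼ y
        touched j∈ i∈ with ∈-image⁻ contract i∈
        ... | _ , i′∈ , refl with ∈-N₀⁻ i′∈
        ...   | x , (x∉ , refl) , y , (y∈ , fy) , x∼y = x , y , ℓ-high x∉ , T⁺ j∈ y∈ fy , x∼y

      -- If `I₁` reaches beyond `I₀`, then `I₁ ∪ I₀` is larger than `I₀` and so not dense;
      -- subtracting the at least `∣ I₀ ∣` indices of `A`, all enclosed in it, gives the bound. If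
      -- `I₁ ⊆ I₀`, an enclosed index would already belong to `A`.
      sparse : Sparse J N
      sparse (s ∷ I₁) (i₀ , i₀∈) with any? (λ i → (i ∈? I₁) ×-dec ¬? (i ∈? I₀))
      ... | yes (i , i∈ , i∉) = ≤-trans (+-cancelʳ-< ∣ A ∣ _ _ (begin-strict
              ∣ J′ ∣ + ∣ A ∣              ≤⟨ disjoint-∣∣ J′ A _ J′⊆ A⊆ (λ j∈ → proj₂ (J⁻ (proj₁ (∈-enclosed⁻ j∈)))) ⟩
              ∣ enclosed J₀ N₀ K ∣        <⟨ larger-sparse K (p⊂q⇒∣p∣<∣q∣ (q⊆p∪q I₁ I₀ , i , x∈p∪q⁺ (inj₁ i∈) , i∉)) ⟩
              ∣ K ∣                       ≤⟨ ∣p∪q∣≤∣p∣+∣q∣ I₁ I₀ ⟩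
              ∣ I₁ ∣ + ∣ I₀ ∣             ≤⟨ +-monoʳ-≤ ∣ I₁ ∣ I₀-dense ⟩
              ∣ I₁ ∣ + ∣ A ∣              ∎)) (∣p∣≤∣x∷p∣ s I₁)
        where
        open ≤-Reasoning
        K = I₁ ∪ I₀
        J′ = enclosed J N (s ∷ I₁)
        J′⊆ : J′ ⊆ enclosed J₀ N₀ K
        J′⊆ {j} j∈ with ∈-enclosed⁻ j∈
        ... | j∈J , N⊆ = ∈-enclosed⁺ (proj₁ (J⁻ j∈J)) back
          where
          back : N₀ j ⊆ K
          back {i} i∈ with i ∈? I₀
          ... | yes i∈I₀ = x∈p∪q⁺ (inj₂ i∈I₀)
          ... | no i∉I₀ = x∈p∪q⁺ (inj₁ (drop-there
                  (subst (_∈ s ∷ I₁) (contract-∉ i∉I₀) (N⊆ (∈-image⁺ contract i∈)))))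
        A⊆ : A ⊆ enclosed J₀ N₀ K
        A⊆ j∈ with ∈-enclosed⁻ j∈
        ... | j∈J₀ , N⊆ = ∈-enclosed⁺ j∈J₀ (λ i∈ → x∈p∪q⁺ (inj₂ (N⊆ i∈)))
      ... | no none = ≤-trans
              (s≤s (≤-reflexive (trans (cong ∣_∣ (Empty-unique empty)) (∣⊥∣≡0 p)))) (x∈p⇒0<∣p∣ i₀∈)
        where
        empty : ¬ Nonempty (enclosed J N (s ∷ I₁))
        empty (j , j∈) with ∈-enclosed⁻ j∈
        ... | j∈J , N⊆ = proj₂ (J⁻ j∈J) (∈-enclosed⁺ (proj₁ (J⁻ j∈J)) back)
          where
          back : N₀ j ⊆ I₀
          back {i} i∈ with i ∈? I₀
          ... | yes i∈I₀ = i∈I₀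
          ... | no i∉I₀ = contradiction
                  (i , drop-there (subst (_∈ s ∷ I₁) (contract-∉ i∉I₀) (N⊆ (∈-image⁺ contract i∈))) , i∉I₀) none

      reached : ∀ u → Reached J T′ ℓ u
      reached u with toSum (u ∈? L) | toSum (f₂ u ∈? A)
      ... | inj₂ u∉ | _ = inj₁ (_ , ℓ-high u∉)
      ... | inj₁ u∈ | inj₁ f∈ = inj₁ (_ , ℓ-absorbed u∈ f∈)
      ... | inj₁ u∈ | inj₂ f∉ = inj₂ (f₂ u , j∈ , T⁺ j∈ u∈ refl)
        where
        j∈ : f₂ u ∈ J
        j∈ = x∈p∩q⁺ (low-index u∈ , x∉p⇒x∈∁p f∉)

    dicolourable : Dicolourable (whole G) c
    dicolourable = whole-dicolourable reached (solve ∣ J ∣ φ ≤-refl zero state sparse)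
      where open Assemble default ℓ colour-proper not-all

-- The inequality for dicritical digraphs

components-positive : ∀ {m} G X → NumComponents G X m → 1 ≤ m
components-positive _ _ (inj₁ (_ , refl)) = ≤-refl
components-positive {suc _} _ _ (inj₂ _) = s≤s z≤n
components-positive {zero} _ _ (inj₂ ((x , _) , f , _)) with f x
... | ()

theorem1p8 : (k : ℕ) → 3 ≤ k → (G : Digraph) → Dicritical k G →
    (m₁ m₂ : ℕ) →
    NumComponents G (∁ (LowSet k G)) m₁ →
    NumComponents G (LowSet k G) m₂ →
    m₁ ≤ m₂
-- From here on `k` is the number of available colours, one less than the dichromatic number.
theorem1p8 (suc k) (s≤s 2≤k) G ((_ , minimum) , critical) m₁ m₂ high low = ≮⇒≥ (refute high low)
  where
  L = LowSet (suc k) G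

  colour-proper : ∀ (H : Subdigraph G) → Proper H → Dicolourable H k
  colour-proper H proper with critical H proper
  ... | c , s≤s c≤k , col , dic = (λ v → inject≤ (col v) c≤k) , λ i x walk →
          dic (col x) x (lower x (start walk) walk)
    where
    Step : Fin k → Fin (n G) → Fin (n G) → Set
    Step i u v = arcs H u v ≡ true × inject≤ (col u) c≤k ≡ i × inject≤ (col v) c≤k ≡ i
    start : ∀ {i x y} → TransClosure (Step i) x y → inject≤ (col x) c≤k ≡ i
    start [ _ , e , _ ] = e
    start ((_ , e , _) ∷ _) = e
    down : ∀ {i u v} x → inject≤ (col x) c≤k ≡ i → Step i u v →
           arcs H u v ≡ true × col u ≡ col x × col v ≡ col x
    down x e (a , eu , ev) = a , inject≤-injective _ _ _ _ (trans eu (sym e)) ,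
      inject≤-injective _ _ _ _ (trans ev (sym e))
    lower : ∀ {i y z} x → inject≤ (col x) c≤k ≡ i → TransClosure (Step i) y z →
            TransClosure (λ u v → arcs H u v ≡ true × col u ≡ col x × col v ≡ col x) y z
    lower x e [ s ] = [ down x e s ]
    lower x e (s ∷ rest) = down x e s ∷ lower x e rest

  low-degree : ∀ {x} → x ∈ L → deg G x ≤ k + k
  low-degree {x} x∈ = ≤-trans
      (≤ᵇ⇒≤ (deg G x) (2 * k) (subst T (sym (∈-tabulate⁻ (λ x → deg G x ≤ᵇ 2 * k) x∈)) _))
    (≤-reflexive (cong (k +_) (+-identityʳ k)))

  default : Fin k
  default = inject≤ zero 2≤k

  refute : NumComponents G (∁ L) m₁ → NumComponents G L m₂ → ¬ m₂ < m₁
  -- With no high vertices the count is 1 by convention, and every count of components is at least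
  -- 1.
  refute (inj₁ (_ , refl)) low m₂<m₁ = <⇒≱ m₂<m₁ (components-positive G L low)
  refute (inj₂ (_ , f₁ , comp₁ , onto₁)) low m₂<m₁ = n≮n k (minimum k (colouring low))
    where
    2≤m₁ : 2 ≤ m₁
    2≤m₁ = ≤-trans (s≤s (components-positive G L low)) m₂<m₁
    adjacent₁ : ∀ {x y} → x ∉ L → y ∉ L → (arc G x y ≡ true) ⊎ (arc G y x ≡ true) → f₁ x ≡ f₁ y
    adjacent₁ x∉ y∉ x∼y = proj₁ (comp₁ _ _ (x∉p⇒x∈∁p x∉) (x∉p⇒x∈∁p y∉))
      ((x∉p⇒x∈∁p x∉ , x∉p⇒x∈∁p y∉ , x∼y) ◅ ε)
    onto₁′ : ∀ i → ∃ λ x → x ∉ L × f₁ x ≡ i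
    onto₁′ i with onto₁ i
    ... | x , x∈ , e = x , x∈∁p⇒x∉p x∈ , e
    colouring : NumComponents G L m₂ → Dicolourable (whole G) k
    -- Without low vertices there is nothing to eliminate: `J₀` is empty and `f₂` is arbitrary.
    colouring (inj₁ (none , _)) = Start.dicolourable G default colour-proper L low-degree 2≤m₁ f₁
      (λ _ → zero {0}) ∅ (≤-trans (s≤s (≤-reflexive (∣⊥∣≡0 1))) (≤-trans (s≤s z≤n) 2≤m₁)) adjacent₁ onto₁′
      (λ x∈ → contradiction x∈ (none _)) (λ x∈ → contradiction x∈ (none _)) (λ j∈ → contradiction j∈ ∉⊥)
      (λ x∈ → contradiction x∈ (none _))
    colouring (inj₂ (_ , f₂ , comp₂ , onto₂)) = Start.dicolourable G default colour-proper L low-degree 2≤m₁ f₁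
      f₂ ⊤ (≤-trans (s≤s (≤-reflexive (∣⊤∣≡n m₂))) m₂<m₁) adjacent₁ onto₁′
      (λ x∈ y∈ → proj₂ (comp₂ _ _ x∈ y∈))
      (λ x∈ y∈ x∼y → proj₁ (comp₂ _ _ x∈ y∈) ((x∈ , y∈ , x∼y) ◅ ε))
      (λ {j} _ → onto₂ j) (λ _ → ∈⊤)
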